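{- Let $n=2^{r+1}p_1\cdots p_k$, where $r\ge 0$, $k\ge 1$ and $p_1,\ldots,p_k$ are (not necessarily distinct) odd primes. Let $a_0,\ldots,a_{r-1}$ be odd integers, let $c$ be an integer divisible by $2^{r+1}$, and let $b_1,\ldots,b_k$ be integers such that $b_i$ is odd and coprime to $p_i$ for each $1\le i\le k$. If $k\ge 2$, let $S$ be the sequence in $\mathbb{Z}_n$ $$(a_0,\ 2a_1,\ \ldots,\ 2^{r-1}a_{r-1},\ c,\ 2^rb_1,\ 2^rp_1b_2,\ \ldots,\ 2^rp_1\cdots p_{k-1}b_k,\ \underbrace{n/2,\ldots,n/2}_{n-1\text{ times}}),$$ and if $k=1$, let $S$ be the sequence $$(a_0,\ 2a_1,\ \ldots,\ 2^{r-1}a_{r-1},\ c,\ 2^r,\ \underbrace{n/2,\ldots,n/2}_{n-1\text{ times}})$$ (when $r=0$ there are no terms $2^ia_i$). Then $S$ is a $U(n)$-extremal sequence for the Gao constant.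
   Context: $\mathbb{Z}_n=\mathbb{Z}/n\mathbb{Z}$ and $U(n)$ is its group of units; integers are identified with their images in $\mathbb{Z}_n$. A sequence is a finite list $(x_1,\ldots,x_l)$ of elements of $\mathbb{Z}_n$ (repetitions allowed); a subsequence is obtained by restricting to a subset of the indices. For $A\subseteq\mathbb{Z}_n$, a subsequence of $(x_1,\ldots,x_l)$ with index set $I$ is an $A$-weighted zero-sum subsequence if $I\ne\emptyset$ and there exist $a_i\in A$ ($i\in I$) with $\sum_{i\in I}a_ix_i=0$. The $A$-weighted Gao constant $E_A(n)$ is the least positive integer $k$ such that every sequence of length $k$ in $\mathbb{Z}_n$ has an $A$-weighted zero-sum subsequence of length $n$. An $A$-extremal sequence for the Gao constant is a sequence in $\mathbb{Z}_n$ of length $E_A(n)-1$ which has no $A$-weighted zero-sum subsequence of length $n$. -}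

module Defs where

open import Algebra.Bundles using (CommutativeRing)
open import Algebra.Definitions using (Invertible)
import Algebra.Definitions.RawMonoid as RawMonoidDefs
open import Data.Bool.Base using (if_then_else_)
open import Data.Fin.Base using (Fin; toℕ)
open import Data.Fin.Subset using (Subset; Nonempty; ∣_∣; _∈_)
open import Data.Integer.Base using (ℤ; +_; -_; _-_; 0ℤ; 1ℤ) renaming (_+_ to _+ᶻ_; _*_ to _*ᶻ_)
open import Data.Integer.Divisibility.Signed using (_∣_; divides; ∣m∣n⇒∣m+n; ∣m⇒∣-m; ∣n⇒∣m*n)
import Data.Integer.Properties as ℤₚ
open import Data.Integer.Tactic.RingSolver using (solve-∀)
open import Data.List.Base using (List; []; _∷_; [_]; _++_; length; lookup; replicate; tabulate; take)
open import Data.Nat.Base using (ℕ; suc; _≤_; _∸_; _*_; _^_)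
open import Data.Nat.DivMod using (_/_)
open import Data.Nat.ListAction using (product)
open import Data.Product.Base using (_×_; _,_; ∃; ∃-syntax)
open import Data.Vec.Base as Vec using ()
open import Level using (0ℓ)
open import Relation.Binary.PropositionalEquality using (_≡_; refl; sym; subst)
open import Relation.Nullary using (¬_)
open import Relation.Unary using (Pred)

-- ℤₙ is the setoid of integers under congruence, so that an integer is its own
-- image in ℤₙ.
infix 4 _≡_[mod_]

record _≡_[mod_] (x y : ℤ) (n : ℕ) : Set where
  constructor mod
  field n∣x-y : + n ∣ x - y

module _ (n : ℕ) where

  private
    infix 4 _≈_
    _≈_ : ℤ → ℤ → Set
    x ≈ y = x ≡ y [mod n ]

    ≈-reflexive : ∀ {x y} → x ≡ y → x ≈ y
    ≈-reflexive {x} refl = mod (divides 0ℤ (ℤₚ.+-inverseʳ x))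

    ≈-sym : ∀ {x y} → x ≈ y → y ≈ x
    ≈-sym {x} {y} (mod p) = mod (subst (+ n ∣_) (eq x y) (∣m⇒∣-m p))
      where
      eq : ∀ x y → - (x - y) ≡ y - x
      eq = solve-∀

    ≈-trans : ∀ {x y z} → x ≈ y → y ≈ z → x ≈ z
    ≈-trans {x} {y} {z} (mod p) (mod q) = mod (subst (+ n ∣_) (eq x y z) (∣m∣n⇒∣m+n p q))
      where
      eq : ∀ x y z → (x - y) +ᶻ (y - z) ≡ x - z
      eq = solve-∀

    +-cong : ∀ {x y u v} → x ≈ y → u ≈ v → x +ᶻ u ≈ y +ᶻ v
    +-cong {x} {y} {u} {v} (mod p) (mod q) = mod (subst (+ n ∣_) (eq x y u v) (∣m∣n⇒∣m+n p q))
      where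
      eq : ∀ x y u v → (x - y) +ᶻ (u - v) ≡ (x +ᶻ u) - (y +ᶻ v)
      eq = solve-∀

    neg-cong : ∀ {x y} → x ≈ y → - x ≈ - y
    neg-cong {x} {y} (mod p) = mod (subst (+ n ∣_) (eq x y) (∣m⇒∣-m p))
      where
      eq : ∀ x y → - (x - y) ≡ - x - - y
      eq = solve-∀

    *-cong : ∀ {x y u v} → x ≈ y → u ≈ v → x *ᶻ u ≈ y *ᶻ v
    *-cong {x} {y} {u} {v} (mod p) (mod q) =
      mod (subst (+ n ∣_) (eq x y u v) (∣m∣n⇒∣m+n (∣n⇒∣m*n u p) (∣n⇒∣m*n y q)))
      where
      eq : ∀ x y u v → u *ᶻ (x - y) +ᶻ y *ᶻ (u - v) ≡ x *ᶻ u - y *ᶻ v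
      eq = solve-∀

  ℤMod : CommutativeRing 0ℓ 0ℓ
  ℤMod = record
    { Carrier = ℤ
    ; _≈_ = _≈_
    ; _+_ = _+ᶻ_
    ; _*_ = _*ᶻ_
    ; -_ = -_
    ; 0# = 0ℤ
    ; 1# = 1ℤ
    ; isCommutativeRing = record
      { isRing = record
        { +-isAbelianGroup = record
          { isGroup = record
            { isMonoid = record
              { isSemigroup = record
                { isMagma = record
                  { isEquivalence = record
                    { refl = ≈-reflexive refl
                    ; sym = ≈-sym
                    ; trans = ≈-trans
                    }
                  ; ∙-cong = +-cong
                  }
                ; assoc = λ x y z → ≈-reflexive (ℤₚ.+-assoc x y z)
                }
              ; identity = (λ x → ≈-reflexive (ℤₚ.+-identityˡ x))
                         , (λ x → ≈-reflexive (ℤₚ.+-identityʳ x))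
              }
            ; inverse = (λ x → ≈-reflexive (ℤₚ.+-inverseˡ x))
                      , (λ x → ≈-reflexive (ℤₚ.+-inverseʳ x))
            ; ⁻¹-cong = neg-cong
            }
          ; comm = λ x y → ≈-reflexive (ℤₚ.+-comm x y)
          }
        ; *-cong = *-cong
        ; *-assoc = λ x y z → ≈-reflexive (ℤₚ.*-assoc x y z)
        ; *-identity = (λ x → ≈-reflexive (ℤₚ.*-identityˡ x))
                     , (λ x → ≈-reflexive (ℤₚ.*-identityʳ x))
        ; distrib = (λ x y z → ≈-reflexive (ℤₚ.*-distribˡ-+ x y z))
                  , (λ x y z → ≈-reflexive (ℤₚ.*-distribʳ-+ x y z))
        }
      ; *-comm = λ x y → ≈-reflexive (ℤₚ.*-comm x y)
      }
    }

  open CommutativeRing ℤMod using (Carrier; +-rawMonoid; 0#; 1#)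
    renaming (_≈_ to _≋_; _*_ to _·_)
  open RawMonoidDefs +-rawMonoid using (sum)

  U : Pred Carrier 0ℓ
  U = Invertible _≋_ 1# _·_

  -- A predicate A on integers stands for its image in ℤₙ; it need not respect
  -- congruence. The weight function is total, but only its values on I matter.
  WeightedZeroSum : Pred Carrier 0ℓ → (xs : List Carrier) → Subset (length xs) → Set
  WeightedZeroSum A xs I =
    Nonempty I ×
    ∃ λ (a : Fin (length xs) → Carrier) →
      (∀ i → i ∈ I → A (a i)) ×
      sum (λ i → if Vec.lookup I i then a i · lookup xs i else 0#) ≋ 0#

  HasWeightedZeroSumOfLength : Pred Carrier 0ℓ → ℕ → List Carrier → Set
  HasWeightedZeroSumOfLength A m xs = ∃[ I ] ∣ I ∣ ≡ m × WeightedZeroSum A xs I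

  GaoProperty : Pred Carrier 0ℓ → ℕ → Set
  GaoProperty A k = ∀ xs → length xs ≡ k → HasWeightedZeroSumOfLength A n xs

  -- k is E_A(n).
  IsGaoConstant : Pred Carrier 0ℓ → ℕ → Set
  IsGaoConstant A k =
    1 ≤ k × GaoProperty A k × (∀ j → 1 ≤ j → GaoProperty A j → k ≤ j)

  GaoExtremal : Pred Carrier 0ℓ → List Carrier → Set
  GaoExtremal A xs =
    ∃[ E ] IsGaoConstant A E × length xs ≡ E ∸ 1 × ¬ HasWeightedZeroSumOfLength A n xs

Odd : ℤ → Set
Odd x = ¬ (+ 2 ∣ x)

-- Indices start at 0, so p i and b i are p_{i+1} and b_{i+1}, and the prefix
-- product below is p_1 ⋯ p_i.
middleTerms : ℕ → ∀ {k} → (Fin k → ℕ) → (Fin k → ℤ) → List ℤ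
middleTerms r {1} _ _ = [ + (2 ^ r) ]
middleTerms r {_} p b = tabulate λ i → + (2 ^ r * product (take (toℕ i) (tabulate p))) *ᶻ b i

S : (n r : ℕ) {k : ℕ} (p : Fin k → ℕ) (a : Fin r → ℤ) (c : ℤ) (b : Fin k → ℤ) → List ℤ
S n r p a c b =
  tabulate (λ i → + (2 ^ toℕ i) *ᶻ a i) ++
  [ c ] ++
  middleTerms r p b ++
  replicate (n ∸ 1) (+ (n / 2))

-- Write Ω(n) = r + 1 + k, so that the constant is n + Ω(n).
--
-- Upper bound. By the Chinese remainder theorem a set I of indices has a U(n)-weighted zero
-- sum if for every prime p the least p-adic valuation of the terms xᵢ (i ∈ I), when it is less
-- than that of n, is attained at least twice if p is odd and a positive even number of times
-- if p = 2. For odd p this means that I meets none of the sets {i : p^j ∤ xᵢ}, p^j ∣ n, in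
-- exactly one index; call such an I robust. There are k of these sets, and deleting a lone
-- index makes one of them disjoint from I, so robustness costs at most one index for each set
-- that is emptied. The parity at 2 is then corrected by deleting one suitable index together
-- with the indices whose deletion this forces; this costs one index more than the number of
-- sets emptied, which is paid for by one of the r + 1 factors 2. What is still in excess of n is
-- deleted outside a small set that keeps I robust.
--
-- Lower bound. Modulo 2^(r+1) a zero sum of length n avoids the terms 2^i a_i and contains an
-- even number of the terms that are odd multiples of 2^r; as n is even it avoids c. Modulo
-- p_1 ⋯ p_k it avoids the middle terms, which leaves only n − 1 terms.
module Submission where

open import Defs

module RobustSubsets where

  open import Data.Empty using (⊥-elim)
  open import Data.Fin.Base using (Fin; zero; suc)
  import Data.Fin.Properties as Fin
  open import Data.Fin.Subset hiding (⊥)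
  open import Data.Fin.Subset.Properties
  open import Data.List.Base using (List; []; _∷_; length)
  open import Data.List.Relation.Unary.All using (All; []; _∷_)
  open import Data.List.Relation.Unary.All.Properties using (¬Any⇒All¬)
  open import Data.List.Relation.Unary.Any as Any using (Any; here; there)
  open import Data.Nat.Base hiding (∣_-_∣)
  open import Data.Nat.Induction using (<-wellFounded)
  open import Data.Nat.Properties
  open import Data.Nat.Tactic.RingSolver using (solve-∀)
  open import Data.Parity.Base as ℙ using (0ℙ; 1ℙ)
  open import Data.Parity.Properties using (+-homo-+)
  open import Data.Product.Base using (_×_; _,_; ∃; ∃-syntax; proj₁; proj₂)
  open import Data.Sum.Base using (inj₁; inj₂)
  open import Data.Vec.Base as Vec using ([]; _∷_; here; there)
  open import Data.Vec.Properties using (lookup∘tabulate; lookup⇒[]=; []=⇒lookup)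
  open import Function.Base using (_∘_)
  open import Induction.WellFounded using (Acc; acc)
  open import Relation.Binary.PropositionalEquality
  open import Relation.Nullary using (¬_; yes; no; does; contradiction)
  open import Relation.Nullary.Decidable using (dec-true)

  -- Finite subsets: differences and cardinalities.

  ─⇒∉ : ∀ {n} (p q : Subset n) {x} → x ∈ p ─ q → x ∉ q
  ─⇒∉ (s ∷ p) (outside ∷ q) here ()
  ─⇒∉ (s ∷ p) (t ∷ q) (there x∈) (there x∈q) = ─⇒∉ p q x∈ x∈q

  ∣∩∣+∣─∣ : ∀ {n} (F S : Subset n) → ∣ F ∩ S ∣ + ∣ F ─ S ∣ ≡ ∣ F ∣
  ∣∩∣+∣─∣ [] [] = refl
  ∣∩∣+∣─∣ (inside ∷ F) (inside ∷ S) = cong suc (∣∩∣+∣─∣ F S)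
  ∣∩∣+∣─∣ (inside ∷ F) (outside ∷ S) =
    trans (+-suc ∣ F ∩ S ∣ ∣ F ─ S ∣) (cong suc (∣∩∣+∣─∣ F S))
  ∣∩∣+∣─∣ (outside ∷ F) (inside ∷ S) = ∣∩∣+∣─∣ F S
  ∣∩∣+∣─∣ (outside ∷ F) (outside ∷ S) = ∣∩∣+∣─∣ F S

  ∣∪∣≤ : ∀ {n} (p q : Subset n) → ∣ p ∪ q ∣ ≤ ∣ p ∣ + ∣ q ∣
  ∣∪∣≤ [] [] = z≤n
  ∣∪∣≤ (inside ∷ p) (inside ∷ q) =
    s≤s (≤-trans (∣∪∣≤ p q) (+-monoʳ-≤ ∣ p ∣ (n≤1+n ∣ q ∣)))
  ∣∪∣≤ (inside ∷ p) (outside ∷ q) = s≤s (∣∪∣≤ p q)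
  ∣∪∣≤ (outside ∷ p) (inside ∷ q) =
    ≤-trans (s≤s (∣∪∣≤ p q)) (≤-reflexive (sym (+-suc ∣ p ∣ ∣ q ∣)))
  ∣∪∣≤ (outside ∷ p) (outside ∷ q) = ∣∪∣≤ p q

  ∈⇒0<∣∣ : ∀ {n} {p : Subset n} {x} → x ∈ p → 0 < ∣ p ∣
  ∈⇒0<∣∣ {p = p} {x} x∈p = subst (_≤ ∣ p ∣) (∣⁅x⁆∣≡1 x)
    (p⊆q⇒∣p∣≤∣q∣ λ y∈ → subst (_∈ p) (sym (x∈⁅y⁆⇒x≡y x y∈)) x∈p)

  0<∣∣⇒Nonempty : ∀ {n} (p : Subset n) → 0 < ∣ p ∣ → Nonempty p
  0<∣∣⇒Nonempty (inside ∷ p) _ = zero , here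
  0<∣∣⇒Nonempty (outside ∷ p) h =
    let x , x∈p = 0<∣∣⇒Nonempty p h in suc x , there x∈p

  ∣-∣ : ∀ {n} (F : Subset n) {x} → x ∈ F → suc ∣ F - x ∣ ≡ ∣ F ∣
  ∣-∣ F {x} x∈F = trans (cong (_+ ∣ F - x ∣) (sym F∩x)) (∣∩∣+∣─∣ F ⁅ x ⁆)
    where
    F∩x : ∣ F ∩ ⁅ x ⁆ ∣ ≡ 1
    F∩x = trans (cong ∣_∣ (⊆-antisym (p∩q⊆q F ⁅ x ⁆)
      λ y∈ → x∈p∩q⁺ (subst (_∈ F) (sym (x∈⁅y⁆⇒x≡y x y∈)) x∈F , y∈))) (∣⁅x⁆∣≡1 x)

  ∣∣≡1⇒unique : ∀ {n} (p : Subset n) {x y} → ∣ p ∣ ≡ 1 → x ∈ p → y ∈ p → y ≡ x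
  ∣∣≡1⇒unique p {x} {y} ∣p∣≡1 x∈p y∈p with y Fin.≟ x
  ... | yes y≡x = y≡x
  ... | no y≢x = contradiction (∈⇒0<∣∣ (x∈p∧x≢y⇒x∈p-y y∈p y≢x))
    (<-irrefl (sym (suc-injective (trans (∣-∣ p x∈p) ∣p∣≡1))))

  ∩-monoˡ : ∀ {n} {p q : Subset n} (r : Subset n) → p ⊆ q → p ∩ r ⊆ q ∩ r
  ∩-monoˡ {p = p} r p⊆q x∈ =
    let x∈p , x∈r = x∈p∩q⁻ p r x∈ in x∈p∩q⁺ (p⊆q x∈p , x∈r)

  subset-of-size : ∀ {n} (F : Subset n) m → m ≤ ∣ F ∣ → ∃[ G ] G ⊆ F × ∣ G ∣ ≡ m
  subset-of-size {n} F zero _ = Data.Fin.Subset.⊥ , ⊥-elim ∘ ∉⊥ , ∣⊥∣≡0 n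
  subset-of-size (inside ∷ F) (suc m) (s≤s m≤) =
    let G , G⊆F , ∣G∣ = subset-of-size F m m≤ in inside ∷ G , s⊆s G⊆F , cong suc ∣G∣
  subset-of-size (outside ∷ F) (suc m) m≤ =
    let G , G⊆F , ∣G∣ = subset-of-size F (suc m) m≤ in outside ∷ G , s⊆s G⊆F , ∣G∣

  -- Counting the sets that are met, and greatest robust subsets.

  sg : ℕ → ℕ
  sg zero = 0
  sg (suc _) = 1

  sg-mono : ∀ {m n} → m ≤ n → sg m ≤ sg n
  sg-mono z≤n = z≤n
  sg-mono (s≤s _) = ≤-refl

  module _ {N : ℕ} where

    -- The number of members of the list that `F` intersects. It is the budget for deletions: an
    -- index is deleted when some member thereby ceases to be met.
    met : List (Subset N) → Subset N → ℕ
    met [] F = 0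
    met (S ∷ Ss) F = sg ∣ F ∩ S ∣ + met Ss F

    Robust : List (Subset N) → Subset N → Set
    Robust Ss F = All (λ S → ∣ F ∩ S ∣ ≢ 1) Ss

    met≤length : ∀ Ss F → met Ss F ≤ length Ss
    met≤length [] F = z≤n
    met≤length (S ∷ Ss) F = +-mono-≤ (sg≤1 ∣ F ∩ S ∣) (met≤length Ss F)
      where
      sg≤1 : ∀ m → sg m ≤ 1
      sg≤1 zero = z≤n
      sg≤1 (suc _) = ≤-refl

    met-mono : ∀ Ss {F G} → G ⊆ F → met Ss G ≤ met Ss F
    met-mono [] G⊆F = z≤n
    met-mono (S ∷ Ss) G⊆F =
      +-mono-≤ (sg-mono (p⊆q⇒∣p∣≤∣q∣ (∩-monoˡ S G⊆F))) (met-mono Ss G⊆F)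

    module _ (Ss : List (Subset N)) where

      -- `size` bounds the number of deleted indices by the drop of `met`, written without
      -- subtraction: every deletion is charged to a member of `Ss` that is no longer met.
      record Core (F : Subset N) : Set where
        field
          set      : Subset N
          ⊆F       : set ⊆ F
          robust   : Robust Ss set
          size     : ∣ F ∣ + met Ss set ≤ ∣ set ∣ + met Ss F
          greatest : ∀ {G} → G ⊆ F → Robust Ss G → G ⊆ set

      LoneIn : Subset N → Fin N → Subset N → Set
      LoneIn F x S = ∣ F ∩ S ∣ ≡ 1 × x ∈ F × x ∈ S

      lone-element : ∀ F {Ts} → Any (λ S → ∣ F ∩ S ∣ ≡ 1) Ts → ∃[ x ] x ∈ F × Any (LoneIn F x) Ts
      lone-element F (here {S} eq) =
        let x , x∈ = 0<∣∣⇒Nonempty (F ∩ S) (≤-reflexive (sym eq))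
            x∈F , x∈S = x∈p∩q⁻ F S x∈
        in x , x∈F , here (eq , x∈F , x∈S)
      lone-element F (there a) = let x , x∈F , b = lone-element F a in x , x∈F , there b

      -- The set in which `x` is alone becomes disjoint from `F - x`; the other sets can only pass
      -- from met to missed.
      met-lone : ∀ F {x Ts} → Any (LoneIn F x) Ts → suc (met Ts (F - x)) ≤ met Ts F
      met-lone F {x} {S ∷ Ts} (here (eq , x∈F , x∈S)) =
        subst₂ (λ a b → suc (sg a + met Ts (F - x)) ≤ sg b + met Ts F)
        (sym (n≤0⇒n≡0 (≮⇒≥ none))) (sym eq) (s≤s (met-mono Ts (p─q⊆p F ⁅ x ⁆)))
        where
        none : ¬ (0 < ∣ (F - x) ∩ S ∣)
        none 0< with 0<∣∣⇒Nonempty ((F - x) ∩ S) 0<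
        ... | y , y∈ with x∈p∩q⁻ (F - x) S y∈
        ... | y∈F-x , y∈S = ─⇒∉ F ⁅ x ⁆ y∈F-x (subst (_∈ ⁅ x ⁆) (sym y≡x) (x∈⁅x⁆ x))
          where
          y≡x : y ≡ x
          y≡x = ∣∣≡1⇒unique (F ∩ S) eq (x∈p∩q⁺ (x∈F , x∈S)) (x∈p∩q⁺ (p─q⊆p F ⁅ x ⁆ y∈F-x , y∈S))
      met-lone F {x} {S ∷ Ts} (there a) = ≤-trans (≤-reflexive (sym (+-suc _ _)))
        (+-mono-≤ (sg-mono (p⊆q⇒∣p∣≤∣q∣ (∩-monoˡ S (p─q⊆p F ⁅ x ⁆)))) (met-lone F a))

      -- If `G` contained `x`, then `G ∩ S` would be nonempty and inside the singleton `F ∩ S`,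
      -- contrary to robustness. Deleting `x` thus loses no robust subset of `F`, which makes the
      -- core greatest.
      lone∉robust : ∀ F {x G Ts} → Any (LoneIn F x) Ts → G ⊆ F → Robust Ts G → x ∉ G
      lone∉robust F {x} {G} {S ∷ _} (here (eq , x∈F , x∈S)) G⊆F (r ∷ _) x∈G =
        r (≤-antisym (subst (∣ G ∩ S ∣ ≤_) eq (p⊆q⇒∣p∣≤∣q∣ (∩-monoˡ S G⊆F)))
          (∈⇒0<∣∣ (x∈p∩q⁺ (x∈G , x∈S))))
      lone∉robust F (there a) G⊆F (_ ∷ rs) = lone∉robust F a G⊆F rs

      -- As long as some set is met exactly once, its lone index is deleted; by `met-lone` each
      -- deletion pays for itself, and by `lone∉robust` none affects a robust subset.
      core′ : ∀ F → Acc _<_ ∣ F ∣ → Core F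
      core′ F (acc rec) with Any.any? (λ S → ∣ F ∩ S ∣ ≟ 1) Ss
      ... | no none = record
        { set = F ; ⊆F = λ x∈ → x∈ ; robust = ¬Any⇒All¬ Ss none
        ; size = ≤-refl ; greatest = λ G⊆F _ → G⊆F }
      ... | yes some = record
        { set = set ; ⊆F = p─q⊆p F ⁅ x ⁆ ∘ ⊆F ; robust = robust
        ; size = begin
            ∣ F ∣ + met Ss set               ≡⟨ cong (_+ met Ss set) (sym (∣-∣ F x∈F)) ⟩
            suc (∣ F - x ∣ + met Ss set)     ≤⟨ s≤s size ⟩
            suc (∣ set ∣ + met Ss (F - x))   ≡⟨ sym (+-suc ∣ set ∣ _) ⟩
            ∣ set ∣ + suc (met Ss (F - x))   ≤⟨ +-monoʳ-≤ ∣ set ∣ (met-lone F lone) ⟩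
            ∣ set ∣ + met Ss F               ∎
        ; greatest = λ {G} G⊆F rG → greatest (G⊆F-x G⊆F rG) rG }
        where
        open ≤-Reasoning
        x : Fin N
        x = proj₁ (lone-element F some)
        x∈F : x ∈ F
        x∈F = proj₁ (proj₂ (lone-element F some))
        lone : Any (LoneIn F x) Ss
        lone = proj₂ (proj₂ (lone-element F some))
        open Core (core′ (F - x) (rec (≤-reflexive (∣-∣ F x∈F))))
        G⊆F-x : ∀ {G} → G ⊆ F → Robust Ss G → G ⊆ F - x
        G⊆F-x G⊆F rG y∈G = x∈p∧x≢y⇒x∈p-y (G⊆F y∈G) λ where refl → lone∉robust F lone G⊆F rG y∈G

      abstract
        core : ∀ F → Core F
        core F = core′ F (<-wellFounded ∣ F ∣)

  -- Parity of intersections and differences.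

  ∣⊆∣ : ∀ {n} {p q : Subset n} → q ⊆ p → ∣ q ∣ + ∣ p ─ q ∣ ≡ ∣ p ∣
  ∣⊆∣ {p = p} {q} q⊆p = trans (cong (λ s → ∣ s ∣ + ∣ p ─ q ∣)
    (⊆-antisym (λ x∈ → x∈p∩q⁺ (q⊆p x∈ , x∈)) (p∩q⊆q p q))) (∣∩∣+∣─∣ p q)

  parity-split : ∀ {n} (p q : Subset n) → parity ∣ p ∣ ≡ parity ∣ p ∩ q ∣ ℙ.+ parity ∣ p ─ q ∣
  parity-split p q = trans (cong parity (sym (∣∩∣+∣─∣ p q))) (+-homo-+ ∣ p ∩ q ∣ ∣ p ─ q ∣)

  ─∁ : ∀ {n} (p q : Subset n) → p ─ ∁ q ≡ p ∩ q
  ─∁ p q = ⊆-antisym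
    (λ x∈ → x∈p∩q⁺ (p─q⊆p p (∁ q) x∈ , x∉∁p⇒x∈p (─⇒∉ p (∁ q) x∈)))
    (λ x∈ → let x∈p , x∈q = x∈p∩q⁻ p q x∈ in x∈p∧x∉q⇒x∈p─q x∈p (x∈p⇒x∉∁p x∈q))

  ∩∁ : ∀ {n} (p q : Subset n) → p ∩ ∁ q ≡ p ─ q
  ∩∁ p q = ⊆-antisym
    (λ x∈ → let x∈p , x∈q = x∈p∩q⁻ p (∁ q) x∈ in x∈p∧x∉q⇒x∈p─q x∈p (x∈∁p⇒x∉p x∈q))
    (λ x∈ → x∈p∩q⁺ (p─q⊆p p q x∈ , x∉p⇒x∈∁p (─⇒∉ p q x∈)))

  -- Distributes `m` deletions over two pools of sizes `t` and `e`, an even number of them in the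
  -- first. The strict bound leaves one unit of slack: for odd `t`, the value `m = t + e` would
  -- force `d = t`.
  even-sum : ∀ t {e m} → 0 < e → m < t + e →
             ∃[ d ] ∃[ d′ ] d ≤ t × d′ ≤ e × d + d′ ≡ m × parity d ≡ 0ℙ
  even-sum zero {e} {m} 0<e m< = 0 , m , z≤n , <⇒≤ m< , refl , refl
  even-sum (suc zero) {e} {m} 0<e (s≤s m≤) = 0 , m , z≤n , m≤ , refl , refl
  even-sum (suc (suc t)) {e} {zero} 0<e m< = 0 , 0 , z≤n , z≤n , refl , refl
  even-sum (suc (suc t)) {e} {suc zero} 0<e m< = 0 , 1 , z≤n , 0<e , refl , refl
  even-sum (suc (suc t)) {e} {suc (suc m)} 0<e (s≤s (s≤s m<)) =
    let d , d′ , d≤ , d′≤ , eq , par = even-sum t 0<e m<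
    in suc (suc d) , d′ , s≤s (s≤s d≤) , d′≤ , cong 2+ eq , par

  -- Parity of down-sets in a finite preorder.

  module _ {N : ℕ} where

    -- The preorder is given by its principal down-sets, `x ∈ down z` meaning x ≤ z; `up z` is then
    -- the principal up-set.
    module _ (down : Fin N → Subset N)
             (down-refl : ∀ z → z ∈ down z)
             (down-trans : ∀ {x y z} → x ∈ down y → y ∈ down z → x ∈ down z) where

      up : Fin N → Subset N
      up z = Vec.tabulate λ y → does (z ∈? down y)

      ∈up⁺ : ∀ {y z} → z ∈ down y → y ∈ up z
      ∈up⁺ {y} {z} z∈ = lookup⇒[]= y (up z) (trans (lookup∘tabulate _ y) (dec-true (z ∈? down y) z∈))

      ∈up⁻ : ∀ {y z} → y ∈ up z → z ∈ down y
      ∈up⁻ {y} {z} y∈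
        with z ∈? down y
        | trans (sym (lookup∘tabulate (λ y → does (z ∈? down y)) y)) ([]=⇒lookup y∈)
      ... | yes z∈ | _ = z∈

      -- Let B be the class of z for the equivalence y ≤ z ≤ y. If B is even it can be discarded,
      -- since every down-set contains all or nothing of it; if B is odd but the down-set of z is
      -- even, there is an odd number of elements strictly below z.
      odd-down′ : ∀ M → Acc _<_ ∣ M ∣ → parity ∣ M ∣ ≡ 1ℙ →
                  ∃[ z ] z ∈ M × parity ∣ M ∩ down z ∣ ≡ 1ℙ
      odd-down′ M (acc rec) odd
        with 0<∣∣⇒Nonempty M (n≢0⇒n>0 λ eq → contradiction (trans (sym odd) (cong parity eq)) λ ())
      ... | z , z∈M with parity ∣ M ∩ down z ∣ in A-parity
      ... | 1ℙ = z , z∈M , A-parity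
      ... | 0ℙ with parity ∣ (M ∩ down z) ∩ up z ∣ in B-parity
      ... | 1ℙ = lift (odd-down′ A─B
        (rec (p⊂q⇒∣p∣<∣q∣
        (A─B⊆M , z , z∈M , λ z∈ → ─⇒∉ (M ∩ down z) (up z) z∈ (∈up⁺ (down-refl z))))) A─B-odd)
        where
        A─B : Subset N
        A─B = (M ∩ down z) ─ up z
        A─B⊆A : A─B ⊆ M ∩ down z
        A─B⊆A = p─q⊆p (M ∩ down z) (up z)
        A─B⊆M : A─B ⊆ M
        A─B⊆M = p∩q⊆p M (down z) ∘ A─B⊆A
        A─B-odd : parity ∣ A─B ∣ ≡ 1ℙ
        A─B-odd with parity ∣ A─B ∣
          | trans (sym A-parity) (trans (parity-split (M ∩ down z) (up z)) (cong (ℙ._+ parity ∣ A─B ∣) B-parity))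
        ... | 1ℙ | _ = refl
        ... | 0ℙ | ()
        -- `A─B` is down-closed within `M`: whatever lies below some `w` strictly below `z` is
        -- itself strictly below `z`. So `M` and `A─B` have the same trace on `down w`.
        lift : (∃[ w ] w ∈ A─B × parity ∣ A─B ∩ down w ∣ ≡ 1ℙ) → ∃[ w ] w ∈ M × parity ∣ M ∩ down w ∣ ≡ 1ℙ
        lift (w , w∈ , p) = w , A─B⊆M w∈ , trans (cong (parity ∘ ∣_∣) (⊆-antisym above below)) p
          where
          below : A─B ∩ down w ⊆ M ∩ down w
          below = ∩-monoˡ (down w) A─B⊆M
          above : M ∩ down w ⊆ A─B ∩ down w
          above x∈ = let x∈M , x∈w = x∈p∩q⁻ M (down w) x∈ in
            x∈p∩q⁺ (x∈p∧x∉q⇒x∈p─q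
              (x∈p∩q⁺ (x∈M , down-trans x∈w (p∩q⊆q M (down z) (A─B⊆A w∈))))
              (λ x∈up → ─⇒∉ (M ∩ down z) (up z) w∈ (∈up⁺ (down-trans (∈up⁻ {z = z} x∈up) x∈w)))
            , x∈w)
      ... | 0ℙ = lift (odd-down′ M─B
        (rec (p⊂q⇒∣p∣<∣q∣ (p─q⊆p M B , z , z∈M ,
        λ z∈ → ─⇒∉ M B z∈ (x∈p∩q⁺ (down-refl z , ∈up⁺ (down-refl z)))))) M─B-odd)
        where
        B : Subset N
        B = down z ∩ up z
        M─B : Subset N
        M─B = M ─ B
        MB-even : parity ∣ M ∩ B ∣ ≡ 0ℙ
        MB-even = trans (cong (parity ∘ ∣_∣) (sym (∩-assoc M (down z) (up z)))) B-parity
        M─B-odd : parity ∣ M─B ∣ ≡ 1ℙ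
        M─B-odd = sym (trans (sym odd) (trans (parity-split M B) (cong (ℙ._+ parity ∣ M─B ∣) MB-even)))
        inB : ∀ w → parity ∣ (M ∩ down w) ∩ B ∣ ≡ 0ℙ
        inB w with z ∈? down w
        ... | yes z∈w = trans (cong (parity ∘ ∣_∣) (⊆-antisym (∩-monoˡ B (p∩q⊆p M (down w)))
                λ x∈ → let x∈M , x∈B = x∈p∩q⁻ M B x∈ in
                  x∈p∩q⁺ (x∈p∩q⁺ (x∈M , down-trans (p∩q⊆p (down z) (up z) x∈B) z∈w) , x∈B)))
                MB-even
        ... | no z∉w = cong parity (n≤0⇒n≡0 (≮⇒≥ λ 0< →
                let x , x∈ = 0<∣∣⇒Nonempty _ 0<
                    x∈Mw , x∈B = x∈p∩q⁻ (M ∩ down w) B x∈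
                in z∉w (down-trans (∈up⁻ {z = z} (p∩q⊆q (down z) (up z) x∈B)) (p∩q⊆q M (down w) x∈Mw))))
        outB : ∀ w → (M ∩ down w) ─ B ≡ M─B ∩ down w
        outB w = ⊆-antisym
          (λ x∈ → let x∈M , x∈w = x∈p∩q⁻ M (down w) (p─q⊆p (M ∩ down w) B x∈) in
            x∈p∩q⁺ (x∈p∧x∉q⇒x∈p─q x∈M (─⇒∉ (M ∩ down w) B x∈) , x∈w))
          (λ x∈ → let x∈M─B , x∈w = x∈p∩q⁻ M─B (down w) x∈ in
            x∈p∧x∉q⇒x∈p─q (x∈p∩q⁺ (p─q⊆p M B x∈M─B , x∈w)) (─⇒∉ M B x∈M─B))
        lift : (∃[ w ] w ∈ M─B × parity ∣ M─B ∩ down w ∣ ≡ 1ℙ) → ∃[ w ] w ∈ M × parity ∣ M ∩ down w ∣ ≡ 1ℙ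
        lift (w , w∈ , p) = w , p─q⊆p M B w∈ ,
          trans (parity-split (M ∩ down w) B)
            (cong₂ ℙ._+_ (inB w) (trans (cong (parity ∘ ∣_∣) (outB w)) p))

      odd-down : ∀ M → parity ∣ M ∣ ≡ 1ℙ → ∃[ z ] z ∈ M × parity ∣ M ∩ down z ∣ ≡ 1ℙ
      odd-down M = odd-down′ M (<-wellFounded ∣ M ∣)

    -- Robust subsets with an even intersection.

    module _ (Ss : List (Subset N)) where

      -- `size` grants one deletion beyond those charged to sets that cease to be met. `size─`
      -- grants no such extra deletion outside `M`, so that a majority outside `M` can survive.
      record EvenPart (F M : Subset N) : Set where
        field
          set    : Subset N
          ⊆F     : set ⊆ F
          robust : Robust Ss set
          even   : parity ∣ set ∩ M ∣ ≡ 0ℙ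
          size   : ∣ F ∣ + met Ss set ≤ suc (∣ set ∣ + met Ss F)
          size─  : ∣ F ─ M ∣ + met Ss set ≤ ∣ set ─ M ∣ + met Ss F

      -- The preorder: y ≤ z when every robust subset of F avoiding z avoids y.
      odd-core : ∀ F M → parity ∣ F ∩ M ∣ ≡ 1ℙ →
                 ∃[ z ] z ∈ F ∩ M × ∃ λ (C : Core Ss (F - z)) → parity ∣ (F ∩ M) ∩ ∁ (Core.set C) ∣ ≡ 1ℙ
      odd-core F M odd =
        let z , z∈FM , odd′ = odd-down down down-refl down-trans (F ∩ M) odd in z , z∈FM , core- z , odd′
        where
        core- : ∀ z → Core Ss (F - z)
        core- z = core Ss (F - z)
        down : Fin N → Subset N
        down z = ∁ (Core.set (core- z))
        down-refl : ∀ z → z ∈ down z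
        down-refl z = x∉p⇒x∈∁p λ z∈ → ─⇒∉ F ⁅ z ⁆ (Core.⊆F (core- z) z∈) (x∈⁅x⁆ z)
        down-trans : ∀ {x y z} → x ∈ down y → y ∈ down z → x ∈ down z
        -- The core of `F - z` avoids `y`, so it is a robust subset of `F - y` and lies in the core
        -- of `F - y`, which avoids `x`.
        down-trans {x} {y} {z} x∈ y∈ = x∉p⇒x∈∁p λ x∈z → x∈∁p⇒x∉p x∈
          (Core.greatest (core- y)
            (λ {w} w∈ → x∈p∧x≢y⇒x∈p-y (p─q⊆p F ⁅ z ⁆ (Core.⊆F (core- z) w∈))
              λ { refl → x∈∁p⇒x∉p y∈ w∈ })
            (Core.robust (core- z)) x∈z)

      -- Passing to the core of `F - z` removes an odd number of elements from the odd set `F ∩ M`,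
      -- which leaves an even number.
      even-part-odd : ∀ F M {z} → parity ∣ F ∩ M ∣ ≡ 1ℙ → z ∈ F ∩ M → (C : Core Ss (F - z)) →
                      parity ∣ (F ∩ M) ∩ ∁ (Core.set C) ∣ ≡ 1ℙ → EvenPart F M
      even-part-odd F M {z} FM-odd z∈FM C odd = record
        { set = G ; ⊆F = G⊆F ; robust = C.robust ; even = G-even ; size = size ; size─ = size─ }
        where
        module C = Core C
        G : Subset N
        G = C.set
        G⊆F : G ⊆ F
        G⊆F = p─q⊆p F ⁅ z ⁆ ∘ C.⊆F
        FM─∁G : (F ∩ M) ─ ∁ G ≡ G ∩ M
        FM─∁G = trans (─∁ (F ∩ M) G) (⊆-antisym
          (λ x∈ → let x∈FM , x∈G = x∈p∩q⁻ (F ∩ M) G x∈ in x∈p∩q⁺ (x∈G , p∩q⊆q F M x∈FM))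
          (λ x∈ → let x∈G , x∈M = x∈p∩q⁻ G M x∈ in x∈p∩q⁺ (x∈p∩q⁺ (G⊆F x∈G , x∈M) , x∈G)))
        G-even : parity ∣ G ∩ M ∣ ≡ 0ℙ
        G-even with parity ∣ G ∩ M ∣ | trans (sym FM-odd) (trans (parity-split (F ∩ M) (∁ G))
                     (cong₂ ℙ._+_ odd (cong (parity ∘ ∣_∣) FM─∁G)))
        ... | 0ℙ | _ = refl
        ... | 1ℙ | ()
        size : ∣ F ∣ + met Ss G ≤ suc (∣ G ∣ + met Ss F)
        size = begin
          ∣ F ∣ + met Ss G             ≡⟨ cong (_+ met Ss G) (sym (∣-∣ F (p∩q⊆p F M z∈FM))) ⟩
          suc (∣ F - z ∣ + met Ss G)   ≤⟨ s≤s C.size ⟩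
          suc (∣ G ∣ + met Ss (F - z)) ≤⟨ s≤s (+-monoʳ-≤ ∣ G ∣ (met-mono Ss (p─q⊆p F ⁅ z ⁆))) ⟩
          suc (∣ G ∣ + met Ss F)       ∎
          where open ≤-Reasoning
        -- The index `z` lies in `M`, so the one uncharged deletion is absorbed by `F ∩ M` and does
        -- not count outside `M`.
        GM<FM : ∣ G ∩ M ∣ < ∣ F ∩ M ∣
        GM<FM = p⊂q⇒∣p∣<∣q∣ (∩-monoˡ M G⊆F , z , z∈FM ,
          λ z∈ → ─⇒∉ F ⁅ z ⁆ (C.⊆F (p∩q⊆p G M z∈)) (x∈⁅x⁆ z))
        size─ : ∣ F ─ M ∣ + met Ss G ≤ ∣ G ─ M ∣ + met Ss F
        size─ = +-cancelˡ-≤ ∣ F ∩ M ∣ _ _ (begin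
          ∣ F ∩ M ∣ + (∣ F ─ M ∣ + met Ss G)       ≡⟨ sym (+-assoc ∣ F ∩ M ∣ ∣ F ─ M ∣ (met Ss G)) ⟩
          ∣ F ∩ M ∣ + ∣ F ─ M ∣ + met Ss G         ≡⟨ cong (_+ met Ss G) (∣∩∣+∣─∣ F M) ⟩
          ∣ F ∣ + met Ss G                         ≤⟨ size ⟩
          suc (∣ G ∣ + met Ss F)                   ≡⟨ cong (λ s → suc (s + met Ss F)) (sym (∣∩∣+∣─∣ G M)) ⟩
          suc (∣ G ∩ M ∣ + ∣ G ─ M ∣ + met Ss F)   ≡⟨ cong suc (+-assoc ∣ G ∩ M ∣ ∣ G ─ M ∣ (met Ss F)) ⟩
          suc ∣ G ∩ M ∣ + (∣ G ─ M ∣ + met Ss F)   ≤⟨ +-monoˡ-≤ _ GM<FM ⟩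
          ∣ F ∩ M ∣ + (∣ G ─ M ∣ + met Ss F)       ∎)
          where open ≤-Reasoning

      abstract
        even-part : ∀ F M → Robust Ss F → EvenPart F M
        even-part F M robust with parity ∣ F ∩ M ∣ in FM-parity
        ... | 0ℙ = record { set = F ; ⊆F = λ x∈ → x∈ ; robust = robust ; even = FM-parity
                          ; size = n≤1+n _ ; size─ = ≤-refl }
        ... | 1ℙ = let z , z∈FM , C , odd = odd-core F M FM-parity in even-part-odd F M FM-parity z∈FM C odd

    -- Small witnesses of robustness, and trimming to a prescribed size.

    keep : ∀ Ss F → Robust {N} Ss F →
           ∃[ K ] K ⊆ F × ∣ K ∣ ≤ 2 * met Ss F × (∀ {G} → K ⊆ G → G ⊆ F → Robust Ss G)
    keep [] F [] = Data.Fin.Subset.⊥ , ⊥-elim ∘ ∉⊥ , ≤-reflexive (∣⊥∣≡0 N) , λ _ _ → []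
    keep (S ∷ Ss) F (r ∷ rs) with keep Ss F rs | ∣ F ∩ S ∣ in eq
    ... | K , K⊆F , ∣K∣ , robust | 0 = K , K⊆F , ∣K∣ ,
      λ {G} K⊆G G⊆F → (λ ∣GS∣≡1 → contradiction
        (subst₂ _≤_ ∣GS∣≡1 eq (p⊆q⇒∣p∣≤∣q∣ (∩-monoˡ S G⊆F))) λ ()) ∷ robust K⊆G G⊆F
    ... | _ | 1 = contradiction refl r
    -- Two elements of `F ∩ S` go into the witness: every `G` containing them meets `S` at least
    -- twice. This accounts for the factor 2 in the size.
    ... | K , K⊆F , ∣K∣ , robust | suc (suc m)
      with subset-of-size (F ∩ S) 2 (subst (2 ≤_) (sym eq) (s≤s (s≤s z≤n)))
    ... | P , P⊆FS , ∣P∣ = P ∪ K , PK⊆F , size , λ {G} PK⊆G G⊆F →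
      (λ ∣GS∣≡1 → contradiction
        (subst₂ _≤_ ∣P∣ ∣GS∣≡1
          (p⊆q⇒∣p∣≤∣q∣ {p = P} λ x∈P → x∈p∩q⁺ (PK⊆G (p⊆p∪q K x∈P) , p∩q⊆q F S (P⊆FS x∈P)))) λ { (s≤s ()) })
      ∷ robust (PK⊆G ∘ q⊆p∪q P K) G⊆F
      where
      PK⊆F : P ∪ K ⊆ F
      PK⊆F x∈ with x∈p∪q⁻ P K x∈
      ... | inj₁ x∈P = p∩q⊆p F S (P⊆FS x∈P)
      ... | inj₂ x∈K = K⊆F x∈K
      size : ∣ P ∪ K ∣ ≤ 2 * suc (met Ss F)
      size = begin
        ∣ P ∪ K ∣          ≤⟨ ∣∪∣≤ P K ⟩
        ∣ P ∣ + ∣ K ∣      ≤⟨ +-mono-≤ (≤-reflexive ∣P∣) ∣K∣ ⟩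
        2 + 2 * met Ss F   ≡⟨ sym (*-suc 2 (met Ss F)) ⟩
        2 * suc (met Ss F) ∎
        where open ≤-Reasoning

    between : ∀ {F K : Subset N} {L} → K ⊆ F → ∣ K ∣ ≤ L → L ≤ ∣ F ∣ →
              ∃[ G ] K ⊆ G × G ⊆ F × ∣ G ∣ ≡ L
    between {F} {K} {L} K⊆F K≤L L≤F = F ─ D , K⊆F─D , p─q⊆p F D , ∣F─D∣
      where
      ∣F∣≡ : ∣ K ∣ + ∣ F ─ K ∣ ≡ ∣ F ∣
      ∣F∣≡ = ∣⊆∣ K⊆F
      D×  : ∃[ D ] D ⊆ F ─ K × ∣ D ∣ ≡ ∣ F ∣ ∸ L
      D× = subset-of-size (F ─ K) (∣ F ∣ ∸ L)
        (≤-trans (∸-monoʳ-≤ ∣ F ∣ K≤L) (≤-reflexive (trans (cong (_∸ ∣ K ∣) (sym ∣F∣≡)) (m+n∸m≡n ∣ K ∣ _))))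
      D : Subset N
      D = proj₁ D×
      D⊆ : D ⊆ F ─ K
      D⊆ = proj₁ (proj₂ D×)
      K⊆F─D : K ⊆ F ─ D
      K⊆F─D x∈K = x∈p∧x∉q⇒x∈p─q (K⊆F x∈K) λ x∈D → ─⇒∉ F K (D⊆ x∈D) x∈K
      ∣F─D∣ : ∣ F ─ D ∣ ≡ L
      ∣F─D∣ = +-cancelˡ-≡ (∣ F ∣ ∸ L) _ _ (trans (cong (_+ ∣ F ─ D ∣) (sym (proj₂ (proj₂ D×))))
        (trans (∣⊆∣ (p─q⊆p F K ∘ D⊆)) (sym (m∸n+n≡m L≤F))))

    abstract
      -- The surplus indices are deleted from `F ─ K`, an even number of them from `M`. The
      -- strictness of `∣ K ∣ < L` and an index outside `K` and `M` provide the slack that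
      -- `even-sum` requires.
      trim : ∀ {F K : Subset N} {L} M → K ⊆ F → ∣ K ∣ < L → L ≤ ∣ F ∣ → Nonempty (F ─ K ─ M) →
             parity ∣ F ∩ M ∣ ≡ 0ℙ →
             ∃[ G ] K ⊆ G × G ⊆ F × ∣ G ∣ ≡ L × parity ∣ G ∩ M ∣ ≡ 0ℙ
      trim {F} {K} {L} M K⊆F K<L L≤F (_ , x∈) FM-even
        with even-sum ∣ (F ─ K) ∩ M ∣ {∣ F ─ K ─ M ∣} {∣ F ∣ ∸ L} (∈⇒0<∣∣ x∈) bound
        where
        bound : ∣ F ∣ ∸ L < ∣ (F ─ K) ∩ M ∣ + ∣ F ─ K ─ M ∣
        bound = subst (∣ F ∣ ∸ L <_)
          (trans (cong (_∸ ∣ K ∣) (sym (∣⊆∣ K⊆F))) (trans (m+n∸m≡n ∣ K ∣ _) (sym (∣∩∣+∣─∣ (F ─ K) M))))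
          (∸-monoʳ-< K<L L≤F)
      ... | d , d′ , d≤ , d′≤ , d+d′ , d-even
        with subset-of-size ((F ─ K) ∩ M) d d≤ | subset-of-size (F ─ K ─ M) d′ d′≤
      ... | D , D⊆ , ∣D∣ | D′ , D′⊆ , ∣D′∣ = F ─ E , K⊆ , p─q⊆p F E , size , even
        where
        E : Subset N
        E = D ∪ D′
        E⊆F─K : E ⊆ F ─ K
        E⊆F─K x∈ with x∈p∪q⁻ D D′ x∈
        ... | inj₁ x∈D = p∩q⊆p (F ─ K) M (D⊆ x∈D)
        ... | inj₂ x∈D′ = p─q⊆p (F ─ K) M (D′⊆ x∈D′)
        K⊆ : K ⊆ F ─ E
        K⊆ x∈K = x∈p∧x∉q⇒x∈p─q (K⊆F x∈K) λ x∈E → ─⇒∉ F K (E⊆F─K x∈E) x∈K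
        E∩M : E ∩ M ≡ D
        E∩M = ⊆-antisym to λ x∈ → x∈p∩q⁺ (p⊆p∪q D′ x∈ , p∩q⊆q (F ─ K) M (D⊆ x∈))
          where
          to : E ∩ M ⊆ D
          to x∈ with x∈p∩q⁻ E M x∈
          ... | x∈E , x∈M with x∈p∪q⁻ D D′ x∈E
          ... | inj₁ x∈D = x∈D
          ... | inj₂ x∈D′ = contradiction x∈M (─⇒∉ (F ─ K) M (D′⊆ x∈D′))
        E─M : E ─ M ≡ D′
        E─M = ⊆-antisym to λ x∈ → x∈p∧x∉q⇒x∈p─q (q⊆p∪q D D′ x∈) (─⇒∉ (F ─ K) M (D′⊆ x∈))
          where
          to : E ─ M ⊆ D′
          to x∈ with x∈p∪q⁻ D D′ (p─q⊆p E M x∈)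
          ... | inj₁ x∈D = contradiction (p∩q⊆q (F ─ K) M (D⊆ x∈D)) (─⇒∉ E M x∈)
          ... | inj₂ x∈D′ = x∈D′
        ∣E∣ : ∣ E ∣ ≡ ∣ F ∣ ∸ L
        ∣E∣ = trans (sym (∣∩∣+∣─∣ E M)) (trans (cong₂ (λ a b → ∣ a ∣ + ∣ b ∣) E∩M E─M)
          (trans (cong₂ _+_ ∣D∣ ∣D′∣) d+d′))
        size : ∣ F ─ E ∣ ≡ L
        size = +-cancelˡ-≡ (∣ F ∣ ∸ L) _ _ (trans (cong (_+ ∣ F ─ E ∣) (sym ∣E∣))
          (trans (∣⊆∣ (p─q⊆p F K ∘ E⊆F─K)) (sym (m∸n+n≡m L≤F))))
        D⊆FM : D ⊆ F ∩ M
        D⊆FM x∈ = let x∈FK , x∈M = x∈p∩q⁻ (F ─ K) M (D⊆ x∈) in x∈p∩q⁺ (p─q⊆p F K x∈FK , x∈M)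
        FM─D : (F ∩ M) ─ D ≡ (F ─ E) ∩ M
        FM─D = ⊆-antisym
          (λ x∈ → let x∈F , x∈M = x∈p∩q⁻ F M (p─q⊆p (F ∩ M) D x∈) in
            x∈p∩q⁺ (x∈p∧x∉q⇒x∈p─q x∈F
              (λ x∈E → ─⇒∉ (F ∩ M) D x∈ (subst (_ ∈_) E∩M (x∈p∩q⁺ (x∈E , x∈M)))) , x∈M))
          (λ x∈ → let x∈FE , x∈M = x∈p∩q⁻ (F ─ E) M x∈ in
            x∈p∧x∉q⇒x∈p─q (x∈p∩q⁺ (p─q⊆p F E x∈FE , x∈M)) (─⇒∉ F E x∈FE ∘ p⊆p∪q D′))
        even : parity ∣ (F ─ E) ∩ M ∣ ≡ 0ℙ
        even = trans (cong (parity ∘ ∣_∣) (sym FM─D))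
          (trans (cong (ℙ._+ parity ∣ (F ∩ M) ─ D ∣) (sym (trans (cong parity ∣D∣) d-even)))
            (trans (sym (+-homo-+ ∣ D ∣ _)) (trans (cong parity (∣⊆∣ D⊆FM)) FM-even)))

    -- For the chain of the sets {i : 2^j ∤ xᵢ} this says that the least 2-adic valuation on F,
    -- if it is below the length of the chain, is attained an even number of times.
    data Balanced (F : Subset N) : List (Subset N) → Set where
      [] : Balanced F []
      meets : ∀ {T Ts} → 0 < ∣ F ∩ T ∣ → parity ∣ F ∩ T ∣ ≡ 0ℙ → Balanced F (T ∷ Ts)
      misses : ∀ {T Ts} → ∣ F ∩ T ∣ ≡ 0 → Balanced F Ts → Balanced F (T ∷ Ts)

    -- Sets G of even size meet T and its complement with the same parity, so that parity can be
    -- controlled on the smaller of the two.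
    minority : ∀ F T → ∃ λ (M : Subset N) → ∣ F ∣ ≤ 2 * ∣ F ─ M ∣ ×
               (∀ G → parity ∣ G ∣ ≡ 0ℙ → parity ∣ G ∩ M ∣ ≡ 0ℙ → parity ∣ G ∩ T ∣ ≡ 0ℙ)
    minority F T with ≤-total ∣ F ∩ T ∣ ∣ F ─ T ∣
    ... | inj₁ few = T , half , λ G _ even → even
      where
      half : ∣ F ∣ ≤ 2 * ∣ F ─ T ∣
      half = ≤-trans (≤-reflexive (sym (∣∩∣+∣─∣ F T))) (≤-trans (+-monoˡ-≤ _ few)
        (≤-reflexive (cong (∣ F ─ T ∣ +_) (sym (+-identityʳ _)))))
    ... | inj₂ many = ∁ T , half , λ G G-even GM-even → even G (trans (sym (parity-split G T)) G-even)
          (trans (cong (parity ∘ ∣_∣) (sym (∩∁ G T))) GM-even)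
      where
      half : ∣ F ∣ ≤ 2 * ∣ F ─ ∁ T ∣
      half = ≤-trans (≤-reflexive (sym (∣∩∣+∣─∣ F T))) (≤-trans (+-monoʳ-≤ ∣ F ∩ T ∣ many)
        (≤-reflexive (trans (cong (∣ F ∩ T ∣ +_) (sym (+-identityʳ _))) (cong (λ s → 2 * ∣ s ∣) (sym (─∁ F T))))))
      even : ∀ G → parity ∣ G ∩ T ∣ ℙ.+ parity ∣ G ─ T ∣ ≡ 0ℙ → parity ∣ G ─ T ∣ ≡ 0ℙ → parity ∣ G ∩ T ∣ ≡ 0ℙ
      even G eq eq′ with parity ∣ G ∩ T ∣ | parity ∣ G ─ T ∣
      even G refl refl | 0ℙ | 0ℙ = refl

    -- Selecting a robust and balanced set of size `L`.

    module _ (Os : List (Subset N)) (L : ℕ)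
      (L-even : parity L ≡ 0ℙ)
      (L-large : 3 * length Os + 2 ≤ L) where

      record Selection (F : Subset N) (Ts : List (Subset N)) : Set where
        field
          set      : Subset N
          ⊆F       : set ⊆ F
          size     : ∣ set ∣ ≡ L
          robust   : Robust Os set
          balanced : Balanced set Ts

      private
        3met+2≤L : ∀ F → 3 * met Os F + 2 ≤ L
        3met+2≤L F = ≤-trans (+-monoˡ-≤ 2 (*-monoʳ-≤ 3 (met≤length Os F))) L-large

        2met+2≤L : ∀ F → 2 * met Os F + 2 ≤ L
        2met+2≤L F = ≤-trans (+-monoˡ-≤ 2 (*-monoˡ-≤ (met Os F) {2} {3} (s≤s (s≤s z≤n)))) (3met+2≤L F)

      -- The surplus `t` over `L + met` survives, since passing to the core deletes no more indices
      -- than it empties sets.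
      core-large : ∀ {F t} (C : Core Os F) → L + met Os F + t ≤ ∣ F ∣ →
                   L + met Os (Core.set C) + t ≤ ∣ Core.set C ∣
      core-large {F} {t} C large = +-cancelʳ-≤ (met Os F) _ _ (begin
        L + met Os set + t + met Os F   ≡⟨ eq L (met Os set) t (met Os F) ⟩
        L + met Os F + t + met Os set   ≤⟨ +-monoˡ-≤ _ large ⟩
        ∣ F ∣ + met Os set              ≤⟨ size ⟩
        ∣ set ∣ + met Os F              ∎)
        where
        open Core C
        open ≤-Reasoning
        eq : ∀ a b c d → a + b + c + d ≡ a + d + c + b
        eq = solve-∀

      -- Here the surplus drops by one, the price of correcting the parity; `select` pays for it
      -- with one member of the chain.
      even-part-large : ∀ {F M t} (E : EvenPart Os F M) → L + met Os F + suc t ≤ ∣ F ∣ →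
                        L + met Os (EvenPart.set E) + t ≤ ∣ EvenPart.set E ∣
      even-part-large {F} {t = t} E large = +-cancelʳ-≤ (suc (met Os F)) _ _ (begin
        L + met Os set + t + suc (met Os F)   ≡⟨ eq L (met Os set) t (met Os F) ⟩
        L + met Os F + suc t + met Os set     ≤⟨ +-monoˡ-≤ _ large ⟩
        ∣ F ∣ + met Os set                    ≤⟨ size ⟩
        suc (∣ set ∣ + met Os F)              ≡⟨ sym (+-suc ∣ set ∣ (met Os F)) ⟩
        ∣ set ∣ + suc (met Os F)              ∎)
        where
        open EvenPart E
        open ≤-Reasoning
        eq : ∀ a b c d → a + b + c + suc d ≡ a + d + suc c + b
        eq = solve-∀

      -- With `e = met Os F`, the bound `L ≥ 3e + 2` gives `∣ F ∣ ≥ 4e + 3`, and half of this lies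
      -- outside `M`, hence at least `2e + 2` indices. By `size─` and the monotonicity of `met`
      -- enough of them remain in the even part. This is where the coefficient 3 in `L-large` comes
      -- from.
      majority-left : ∀ {F M t} (E : EvenPart Os F M) → L + met Os F + suc t ≤ ∣ F ∣ → ∣ F ∣ ≤ 2 * ∣ F ─ M ∣ →
                      2 * met Os (EvenPart.set E) + 2 ≤ ∣ EvenPart.set E ─ M ∣
      majority-left {F} {M} {t} E large half = +-cancelʳ-≤ (met Os F) _ _ (begin
        2 * e′ + 2 + e       ≡⟨ eq₁ e′ e ⟩
        e′ + (e + 2) + e′    ≤⟨ +-monoʳ-≤ (e′ + (e + 2)) (met-mono Os ⊆F) ⟩
        e′ + (e + 2) + e     ≡⟨ eq₂ e′ e ⟩
        2 * e + 2 + e′       ≤⟨ +-monoˡ-≤ e′ step ⟩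
        ∣ F ─ M ∣ + e′       ≤⟨ size─ ⟩
        ∣ set ─ M ∣ + e      ∎)
        where
        open EvenPart E
        open ≤-Reasoning
        e e′ : ℕ
        e = met Os F
        e′ = met Os set
        eq₁ : ∀ x y → 2 * x + 2 + y ≡ x + (y + 2) + x
        eq₁ = solve-∀
        eq₂ : ∀ x y → x + (y + 2) + y ≡ 2 * y + 2 + x
        eq₂ = solve-∀
        eq₃ : ∀ x → suc (2 * (2 * x + 1)) ≡ 3 * x + 2 + x + 1
        eq₃ = solve-∀
        step : 2 * e + 2 ≤ ∣ F ─ M ∣
        step = subst (_≤ ∣ F ─ M ∣) (sym (+-suc (2 * e) 1)) (*-cancelˡ-< 2 (2 * e + 1) ∣ F ─ M ∣ (begin
          suc (2 * (2 * e + 1))   ≡⟨ eq₃ e ⟩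
          3 * e + 2 + e + 1       ≤⟨ +-mono-≤ (+-monoˡ-≤ e (3met+2≤L F)) (s≤s z≤n) ⟩
          L + e + suc t           ≤⟨ large ⟩
          ∣ F ∣                   ≤⟨ half ⟩
          2 * ∣ F ─ M ∣           ∎))

      -- Induction along the chain, the surplus being at least the number of sets still to be
      -- treated. If the even part misses `T`, the chain is continued on it; otherwise `T` settles
      -- `Balanced` and only trimming to size `L` remains.
      select : ∀ Ts F → L + met Os F + length Ts ≤ ∣ F ∣ → Selection F Ts
      select [] F large =
        let K , K⊆ , ∣K∣ , K-robust = keep Os C.set C.robust
            G , K⊆G , G⊆ , ∣G∣ = between {K = K} K⊆
              (≤-trans ∣K∣ (≤-trans (m≤m+n _ 2) (2met+2≤L C.set)))
              (≤-trans (≤-trans (m≤m+n L _) (m≤m+n _ 0)) (core-large C large))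
        in record { set = G ; ⊆F = C.⊆F ∘ G⊆ ; size = ∣G∣ ; robust = K-robust K⊆G G⊆ ; balanced = [] }
        where
        C : Core Os F
        C = core Os F
        module C = Core C
      select (T ∷ Ts) F large with minority (Core.set (core Os F)) T
      ... | M , half , M⇒T = by-cases _ refl
        where
        C : Core Os F
        C = core Os F
        module C = Core C
        E : EvenPart Os C.set M
        E = even-part Os C.set M C.robust
        module E = EvenPart E
        C-large : L + met Os C.set + suc (length Ts) ≤ ∣ C.set ∣
        C-large = core-large C large
        E-large : L + met Os E.set + length Ts ≤ ∣ E.set ∣
        E-large = even-part-large E C-large
        by-cases : ∀ m → ∣ E.set ∩ T ∣ ≡ m → Selection F (T ∷ Ts)
        by-cases zero eq = record
          { set = R.set ; ⊆F = C.⊆F ∘ E.⊆F ∘ R.⊆F ; size = R.size ; robust = R.robust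
          ; balanced = misses (n≤0⇒n≡0 (subst (∣ R.set ∩ T ∣ ≤_) eq (p⊆q⇒∣p∣≤∣q∣ (∩-monoˡ T R.⊆F)))) R.balanced }
          where module R = Selection (select Ts E.set E-large)
        by-cases (suc m) eq with 0<∣∣⇒Nonempty (E.set ∩ T) (subst (0 <_) (sym eq) (s≤s z≤n))
        ... | x , x∈ET with x∈p∩q⁻ E.set T x∈ET | keep Os E.set E.robust
        ... | x∈E , x∈T | K , K⊆ , ∣K∣ , K-robust =
          let G , K′⊆G , G⊆ , ∣G∣ , GM-even = trim M K′⊆ K′<L
                (≤-trans (≤-trans (m≤m+n L _) (m≤m+n _ _)) E-large) left E.even
          in record
            { set = G ; ⊆F = C.⊆F ∘ E.⊆F ∘ G⊆ ; size = ∣G∣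
            ; robust = K-robust (K′⊆G ∘ p⊆p∪q ⁅ x ⁆) G⊆
            ; balanced = meets (∈⇒0<∣∣ (x∈p∩q⁺ (K′⊆G (q⊆p∪q K ⁅ x ⁆ (x∈⁅x⁆ x)) , x∈T)))
                               (M⇒T G (trans (cong parity ∣G∣) L-even) GM-even) }
          where
          -- The index `x` is kept in addition to `K` so that the trimmed set still meets `T`.
          K′ : Subset N
          K′ = K ∪ ⁅ x ⁆
          K′⊆ : K′ ⊆ E.set
          K′⊆ y∈ with x∈p∪q⁻ K ⁅ x ⁆ y∈
          ... | inj₁ y∈K = K⊆ y∈K
          ... | inj₂ y∈x = subst (_∈ E.set) (sym (x∈⁅y⁆⇒x≡y x y∈x)) x∈E
          ∣K′∣ : ∣ K′ ∣ < 2 * met Os E.set + 2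
          ∣K′∣ = subst (suc ∣ K′ ∣ ≤_) (sym (+-suc _ 1)) (s≤s
            (≤-trans (∣∪∣≤ K ⁅ x ⁆) (+-mono-≤ ∣K∣ (≤-reflexive (∣⁅x⁆∣≡1 x)))))
          K′<L : ∣ K′ ∣ < L
          K′<L = ≤-trans ∣K′∣ (2met+2≤L E.set)
          -- `E.set ─ M` has more elements than `K′`, so some index outside `M` is free to be
          -- deleted.
          left : Nonempty (E.set ─ K′ ─ M)
          left = subst Nonempty (p─q─r≡p─r─q E.set M K′) (0<∣∣⇒Nonempty _
            (+-cancelˡ-< ∣ (E.set ─ M) ∩ K′ ∣ _ _ (begin-strict
              ∣ (E.set ─ M) ∩ K′ ∣ + 0                       ≡⟨ +-identityʳ _ ⟩
              ∣ (E.set ─ M) ∩ K′ ∣                           ≤⟨ ∣p∩q∣≤∣q∣ (E.set ─ M) K′ ⟩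
              ∣ K′ ∣                                         <⟨ ∣K′∣ ⟩
              2 * met Os E.set + 2                           ≤⟨ majority-left E C-large half ⟩
              ∣ E.set ─ M ∣                                  ≡⟨ sym (∣∩∣+∣─∣ (E.set ─ M) K′) ⟩
              ∣ (E.set ─ M) ∩ K′ ∣ + ∣ E.set ─ M ─ K′ ∣      ∎)))
            where open ≤-Reasoning

module WeightedSums where

  import Algebra.Properties.CommutativeMonoid.Sum
  open import Data.Bool.Base using (if_then_else_; not)
  open import Data.Empty using (⊥)
  open import Data.Fin.Base using (Fin; zero; suc; toℕ)
  import Data.Fin.Properties as Fin
  open import Data.Fin.Subset hiding (⊥; _-_)
  open import Data.Fin.Subset.Properties
  open import Data.Integer.Base as ℤ using (ℤ; +_; -_; 0ℤ; 1ℤ; _+_; _*_; _-_)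
  open import Data.Integer.Coprimality using (Coprime)
  open import Data.Integer.Divisibility.Signed
  import Data.Integer.Properties as ℤₚ
  open import Data.Integer.Tactic.RingSolver using (solve-∀)
  open import Data.List.Base as List
    using (List; []; _∷_; [_]; _++_; length; lookup; tabulate; replicate; take; drop)
  open import Data.List.Membership.Propositional using () renaming (_∈_ to _∈ₗ_)
  open import Data.List.Membership.Propositional.Properties using (∈-tabulate⁺)
  open import Data.List.Properties
    using (length-++; length-map; length-replicate; length-tabulate; length-take; map-tabulate;
           tabulate-cong; take++drop≡id; ++-identityʳ)
  open import Data.List.Relation.Unary.All as All using (All; []; _∷_)
  import Data.List.Relation.Unary.All.Properties as All
  open import Data.List.Relation.Unary.Any using (here; there)
  open import Data.Nat.Base as ℕ
    using (ℕ; zero; suc; _^_; _≤_; _<_; z≤n; s≤s; NonZero; parity)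
  import Data.Nat.Coprimality as ℕ
  open import Data.Nat.DivMod using (_/_; m*n/n≡m)
  import Data.Nat.Divisibility as ℕ
  open import Data.Nat.GCD using (module Bézout)
  open import Data.Nat.Induction using (<-wellFounded)
  open import Data.Nat.ListAction using (product)
  open import Data.Nat.ListAction.Properties using (∈⇒∣product)
  open import Data.Nat.Primality
  open import Data.Nat.Primality.Factorisation using (factorise)
  import Data.Nat.Properties as ℕₚ
  open import Data.Nat.Tactic.RingSolver using () renaming (solve-∀ to ℕ-solve-∀)
  open import Data.Parity.Base as ℙ using (0ℙ)
  open import Data.Parity.Properties using (*-homo-*)
  open import Data.Product.Base using (_×_; _,_; ∃; ∃-syntax; proj₁; proj₂)
  open import Data.Sum.Base using (_⊎_; inj₁; inj₂)
  open import Data.Vec.Base as Vec using ([]; _∷_; here; there)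
  open import Data.Vec.Properties using (lookup∘tabulate; lookup⇒[]=; []=⇒lookup)
  open import Function.Base using (_∘_; _$_)
  open import Induction.WellFounded using (Acc; acc)
  open import Relation.Binary.Definitions using (tri<; tri≈; tri>)
  open import Relation.Binary.PropositionalEquality hiding ([_])
  open import Relation.Nullary using (¬_; Dec; yes; no; does; contradiction)
  open import Relation.Nullary.Decidable using (dec-true; dec-false)

  open Algebra.Properties.CommutativeMonoid.Sum ℤₚ.+-0-commutativeMonoid using (sum)
  open RobustSubsets

  -- Units modulo varying `m`.

  record Unit (m : ℕ) (y : ℤ) : Set where
    constructor unit
    field
      inverse : ℤ
      isInverse : + m ∣ y * inverse - 1ℤ

  unit-1 : ∀ m → Unit m 1ℤ
  unit-1 m = unit 1ℤ (divides 0ℤ refl)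

  unit-sym : ∀ {m y} (u : Unit m y) → Unit m (Unit.inverse u)
  unit-sym {m} {y} (unit z d) = unit y (subst (λ w → + m ∣ w - 1ℤ) (ℤₚ.*-comm y z) d)

  unit-cong : ∀ {m y z} → + m ∣ z - y → Unit m y → Unit m z
  unit-cong {m} {y} {z} d (unit w e) = unit w (subst (+ m ∣_) (eq y z w) (∣m∣n⇒∣m+n (∣n⇒∣m*n w d) e))
    where
    eq : ∀ y z w → w * (z - y) + (y * w - 1ℤ) ≡ z * w - 1ℤ
    eq = solve-∀

  unit-* : ∀ {m y z} → Unit m y → Unit m z → Unit m (y * z)
  unit-* {m} {y} {z} (unit y′ d) (unit z′ e) = unit (y′ * z′)
    (subst (+ m ∣_) (eq y y′ z z′) (∣m∣n⇒∣m+n (∣n⇒∣m*n (z * z′) d) e))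
    where
    eq : ∀ y y′ z z′ → z * z′ * (y * y′ - 1ℤ) + (z * z′ - 1ℤ) ≡ y * z * (y′ * z′) - 1ℤ
    eq = solve-∀

  unit-neg : ∀ {m y} → Unit m y → Unit m (- y)
  unit-neg {m} {y} (unit z d) = unit (- z) (subst (+ m ∣_) (eq y z) d)
    where
    eq : ∀ y z → y * z - 1ℤ ≡ - y * - z - 1ℤ
    eq = solve-∀

  unit-mod-∣ : ∀ {m n y} → + m ∣ + n → Unit n y → Unit m y
  unit-mod-∣ d (unit z e) = unit z (∣-trans d e)

  ∣-* : ∀ {a b c d} → a ∣ b → c ∣ d → a * c ∣ b * d
  ∣-* {a} {c = c} (divides q refl) (divides s refl) = divides (q * s) (eq q a s c)
    where
    eq : ∀ q a s c → q * a * (s * c) ≡ q * s * (a * c)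
    eq = solve-∀

  -- (yz − 1)(yw − 1) = 1 − y(z + w − yzw)
  unit-mod-* : ∀ {m n y} → Unit m y → Unit n y → Unit (m ℕ.* n) y
  unit-mod-* {m} {n} {y} (unit z d) (unit w e) = unit (z + w - y * z * w)
    (subst₂ _∣_ (sym (ℤₚ.pos-* m n)) (eq y z w) (∣m⇒∣-m (∣-* d e)))
    where
    eq : ∀ y z w → - ((y * z - 1ℤ) * (y * w - 1ℤ)) ≡ y * (z + w - y * z * w) - 1ℤ
    eq = solve-∀

  unit-mod-^ : ∀ {m y} e → Unit m y → Unit (m ^ e) y
  unit-mod-^ {y = y} zero u = unit 0ℤ (divides (y * 0ℤ - 1ℤ) (sym (ℤₚ.*-identityʳ _)))
  unit-mod-^ (suc e) u = unit-mod-* u (unit-mod-^ e u)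

  prime⇒unit : ∀ {p y} → Prime p → ¬ (+ p ∣ y) → Unit p y
  prime⇒unit {p} {y} p-prime p∤y = from-abs y (from-Bézout (ℕ.coprime-Bézout coprime))
    where
    coprime : ℕ.Coprime p ℤ.∣ y ∣
    coprime (d∣p , d∣y) with prime⇒irreducible p-prime d∣p
    ... | inj₁ d≡1 = d≡1
    ... | inj₂ refl = contradiction (∣ᵤ⇒∣ d∣y) p∤y
    from-Bézout : ∀ {n} → Bézout.Identity 1 p n → Unit p (+ n)
    from-Bézout {n} (Bézout.+- s t eq) = unit (- + t) $ divides (- + s) (begin
      + n * - + t - 1ℤ        ≡⟨ id (+ n) (+ t) ⟩
      - (1ℤ + + t * + n)      ≡⟨ cong (λ w → - (1ℤ + w)) (sym (ℤₚ.pos-* t n)) ⟩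
      - + (1 ℕ.+ t ℕ.* n)     ≡⟨ cong (-_ ∘ +_) eq ⟩
      - + (s ℕ.* p)           ≡⟨ cong -_ (ℤₚ.pos-* s p) ⟩
      - (+ s * + p)           ≡⟨ ℤₚ.neg-distribˡ-* (+ s) (+ p) ⟩
      - + s * + p             ∎)
      where
      open ≡-Reasoning
      id : ∀ n t → n * - t - 1ℤ ≡ - (1ℤ + t * n)
      id = solve-∀
    from-Bézout {n} (Bézout.-+ s t eq) = unit (+ t) $ divides (+ s) (begin
      + n * + t - 1ℤ          ≡⟨ cong (_- 1ℤ) (trans (ℤₚ.*-comm (+ n) (+ t)) (sym (ℤₚ.pos-* t n))) ⟩
      + (t ℕ.* n) - 1ℤ        ≡⟨ cong (λ w → + w - 1ℤ) (sym eq) ⟩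
      1ℤ + + (s ℕ.* p) - 1ℤ   ≡⟨ cong (λ w → 1ℤ + w - 1ℤ) (ℤₚ.pos-* s p) ⟩
      1ℤ + + s * + p - 1ℤ     ≡⟨ id (+ s) (+ p) ⟩
      + s * + p               ∎)
      where
      open ≡-Reasoning
      id : ∀ s p → 1ℤ + s * p - 1ℤ ≡ s * p
      id = solve-∀
    from-abs : ∀ y → Unit p (+ ℤ.∣ y ∣) → Unit p y
    from-abs (+ _) u = u
    from-abs ℤ.-[1+ n ] u = unit-neg u

  prime-∣-* : ∀ {p} → Prime p → ∀ y z → + p ∣ y * z → (+ p ∣ y) ⊎ (+ p ∣ z)
  prime-∣-* {p} p-prime y z d
    with euclidsLemma ℤ.∣ y ∣ ℤ.∣ z ∣ p-prime (subst (p ℕ.∣_) (ℤₚ.abs-* y z) (∣⇒∣ᵤ d))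
  ... | inj₁ e = inj₁ (∣ᵤ⇒∣ e)
  ... | inj₂ e = inj₂ (∣ᵤ⇒∣ e)

  -- Integer weighted sums, in the form used by `WeightedZeroSum`.

  wsum : ∀ {N} → Subset N → (Fin N → ℤ) → (Fin N → ℤ) → ℤ
  wsum F x a = sum λ i → if Vec.lookup F i then a i * x i else 0ℤ

  wsum-+ : ∀ {N} (F : Subset N) x a b → wsum F x (λ i → a i + b i) ≡ wsum F x a + wsum F x b
  wsum-+ [] x a b = refl
  wsum-+ (inside ∷ F) x a b = trans
    (cong (λ w → (a zero + b zero) * x zero + w) (wsum-+ F (x ∘ suc) (a ∘ suc) (b ∘ suc)))
    (eq (a zero) (b zero) (x zero) _ _)
    where
    eq : ∀ a b x s t → (a + b) * x + (s + t) ≡ a * x + s + (b * x + t)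
    eq = solve-∀
  wsum-+ (outside ∷ F) x a b = trans
    (cong (λ w → 0ℤ + w) (wsum-+ F (x ∘ suc) (a ∘ suc) (b ∘ suc)))
    (eq (wsum F (x ∘ suc) (a ∘ suc)) (wsum F (x ∘ suc) (b ∘ suc)))
    where
    eq : ∀ s t → 0ℤ + (s + t) ≡ 0ℤ + s + (0ℤ + t)
    eq = solve-∀

  wsum-* : ∀ {N} (F : Subset N) x c a → wsum F x (λ i → c * a i) ≡ c * wsum F x a
  wsum-* [] x c a = sym (ℤₚ.*-zeroʳ c)
  wsum-* (inside ∷ F) x c a = trans
    (cong (λ w → c * a zero * x zero + w) (wsum-* F (x ∘ suc) c (a ∘ suc)))
    (eq c (a zero) (x zero) _)
    where
    eq : ∀ c a x s → c * a * x + c * s ≡ c * (a * x + s)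
    eq = solve-∀
  wsum-* (outside ∷ F) x c a = trans
    (cong (λ w → 0ℤ + w) (wsum-* F (x ∘ suc) c (a ∘ suc))) (eq c _)
    where
    eq : ∀ c s → 0ℤ + c * s ≡ c * (0ℤ + s)
    eq = solve-∀

  δ : ∀ {N} → Fin N → Fin N → ℤ
  δ i j = if does (i Fin.≟ j) then 1ℤ else 0ℤ

  wsum-0 : ∀ {N} (F : Subset N) x → wsum F x (λ _ → 0ℤ) ≡ 0ℤ
  wsum-0 [] x = refl
  wsum-0 (inside ∷ F) x = trans (ℤₚ.+-identityˡ _) (wsum-0 F (x ∘ suc))
  wsum-0 (outside ∷ F) x = trans (ℤₚ.+-identityˡ _) (wsum-0 F (x ∘ suc))

  wsum-δ : ∀ {N} (F : Subset N) x {i} → i ∈ F → wsum F x (δ i) ≡ x i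
  wsum-δ (_ ∷ F) x here = trans (cong (λ w → 1ℤ * x zero + w) (wsum-0 F (x ∘ suc)))
    (trans (ℤₚ.+-identityʳ _) (ℤₚ.*-identityˡ (x zero)))
  wsum-δ (inside ∷ F) x (there i∈F) = trans (ℤₚ.+-identityˡ _) (wsum-δ F (x ∘ suc) i∈F)
  wsum-δ (outside ∷ F) x (there i∈F) = trans (ℤₚ.+-identityˡ _) (wsum-δ F (x ∘ suc) i∈F)

  wsum-∣ : ∀ {N d} (F : Subset N) x a → (∀ {i} → i ∈ F → d ∣ x i) → d ∣ wsum F x a
  wsum-∣ [] x a d∣ = divides 0ℤ refl
  wsum-∣ (inside ∷ F) x a d∣ =
    ∣m∣n⇒∣m+n (∣n⇒∣m*n (a zero) (d∣ here)) (wsum-∣ F (x ∘ suc) (a ∘ suc) (d∣ ∘ there))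
  wsum-∣ (outside ∷ F) x a d∣ =
    ∣m∣n⇒∣m+n (divides 0ℤ refl) (wsum-∣ F (x ∘ suc) (a ∘ suc) (d∣ ∘ there))

  -- Modulo `d` each term over `S` is `g` and the others vanish. With `d = 2^(v+1)` and `g = 2^v`,
  -- the parity of `∣ F ∩ S ∣` decides whether `d` divides the sum with all weights 1.
  wsum-count : ∀ {N d g} (F S : Subset N) x →
               (∀ {i} → i ∈ F → i ∈ S → d ∣ x i - g) → (∀ {i} → i ∈ F → i ∉ S → d ∣ x i) →
               d ∣ wsum F x (λ _ → 1ℤ) - + ∣ F ∩ S ∣ * g
  wsum-count [] [] x in-S out-S = divides 0ℤ refl
  wsum-count {d = d} {g} (inside ∷ F) (inside ∷ S) x in-S out-S =
    subst (d ∣_) (eq (x zero) g _ (+ ∣ F ∩ S ∣)) (∣m∣n⇒∣m+n (in-S here here)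
      (wsum-count F S (x ∘ suc) (λ i∈F → in-S (there i∈F) ∘ there)
        (λ i∈F i∉S → out-S (there i∈F) λ { (there i∈S) → i∉S i∈S })))
    where
    eq : ∀ x g w c → x - g + (w - c * g) ≡ 1ℤ * x + w - (1ℤ + c) * g
    eq = solve-∀
  wsum-count {d = d} {g} (inside ∷ F) (outside ∷ S) x in-S out-S =
    subst (d ∣_) (eq (x zero) g _ (+ ∣ F ∩ S ∣)) (∣m∣n⇒∣m+n (out-S here λ ())
      (wsum-count F S (x ∘ suc) (λ i∈F → in-S (there i∈F) ∘ there)
        (λ i∈F i∉S → out-S (there i∈F) λ { (there i∈S) → i∉S i∈S })))
    where
    eq : ∀ x g w c → x + (w - c * g) ≡ 1ℤ * x + w - c * g
    eq = solve-∀
  wsum-count {d = d} {g} (outside ∷ F) (s ∷ S) x in-S out-S =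
    subst (λ w → d ∣ w - + ∣ F ∩ S ∣ * g) (sym (ℤₚ.+-identityˡ (wsum F (x ∘ suc) (λ _ → 1ℤ))))
      (wsum-count F S (x ∘ suc) (λ i∈F → in-S (there i∈F) ∘ there)
        (λ i∈F i∉S → out-S (there i∈F) λ { (there i∈S) → i∉S i∈S }))

  δ-refl : ∀ {N} (i : Fin N) → δ i i ≡ 1ℤ
  δ-refl i = cong (if_then 1ℤ else 0ℤ) (dec-true (i Fin.≟ i) refl)

  δ-≢ : ∀ {N} {i j : Fin N} → i ≢ j → δ i j ≡ 0ℤ
  δ-≢ {i = i} {j} i≢j = cong (if_then 1ℤ else 0ℤ) (dec-false (i Fin.≟ j) i≢j)

  even⇒2∣ : ∀ n → parity n ≡ 0ℙ → 2 ℕ.∣ n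
  even⇒2∣ zero _ = 2 ℕ.∣0
  even⇒2∣ (suc (suc n)) even = ℕ.∣m∣n⇒∣m+n ℕ.∣-refl (even⇒2∣ n even)

  p∤1 : ∀ {p} → Prime p → ¬ (+ p ∣ 1ℤ)
  p∤1 p-prime d = contradiction (subst Prime (ℕ.∣1⇒≡1 (∣⇒∣ᵤ d)) p-prime) ¬prime[1]


  even-or-odd-ℕ : ∀ n → (+ 2 ∣ + n) ⊎ (+ 2 ∣ + n - 1ℤ)
  even-or-odd-ℕ zero = inj₁ (divides 0ℤ refl)
  even-or-odd-ℕ (suc n) with even-or-odd-ℕ n
  ... | inj₁ d = inj₂ d
  ... | inj₂ d = inj₁ (subst (+ 2 ∣_) (eq (+ n)) (∣m∣n⇒∣m+n d (∣-refl {+ 2})))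
    where
    eq : ∀ n → n - 1ℤ + + 2 ≡ 1ℤ + n
    eq = solve-∀

  even-or-odd : ∀ y → (+ 2 ∣ y) ⊎ (+ 2 ∣ y - 1ℤ)
  even-or-odd (+ n) = even-or-odd-ℕ n
  even-or-odd ℤ.-[1+ n ] with even-or-odd-ℕ n
  ... | inj₁ d = inj₂ (subst (+ 2 ∣_) (eq (+ n)) (∣m⇒∣-m (∣m∣n⇒∣m+n d (∣-refl {+ 2}))))
    where
    eq : ∀ n → - (n + + 2) ≡ - (1ℤ + n) - 1ℤ
    eq = solve-∀
  ... | inj₂ d = inj₁ (subst (+ 2 ∣_) (eq (+ n)) (∣m⇒∣-m (∣m∣n⇒∣m+n d (∣-refl {+ 2}))))
    where
    eq : ∀ n → - (n - 1ℤ + + 2) ≡ - (1ℤ + n)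
    eq = solve-∀

  -- Sets of terms not divisible by a given integer.

  not-dividing : ∀ {N} → ℤ → (Fin N → ℤ) → Subset N
  not-dividing q x = Vec.tabulate λ i → not (does (q ∣? x i))

  ∈not-dividing⁺ : ∀ {N q} (x : Fin N → ℤ) {i} → ¬ (q ∣ x i) → i ∈ not-dividing q x
  ∈not-dividing⁺ {q = q} x {i} q∤ = lookup⇒[]= i _
    (trans (lookup∘tabulate _ i) (cong not (dec-false (q ∣? x i) q∤)))

  ∈not-dividing⁻ : ∀ {N q} (x : Fin N → ℤ) {i} → i ∈ not-dividing q x → ¬ (q ∣ x i)
  ∈not-dividing⁻ {q = q} x {i} i∈ d with trans (sym (cong not (dec-true (q ∣? x i) d)))
    (trans (sym (lookup∘tabulate (λ i → not (does (q ∣? x i))) i)) ([]=⇒lookup i∈))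
  ... | ()

  not-div : ∀ {N} → (Fin N → ℤ) → ℕ → Subset N
  not-div x q = not-dividing (+ q) x

  -- The exponents run from `v + 1` to `v + m`; the start varies because `2-power-solvable` moves it
  -- past the sets that are missed.
  2-chain : ∀ {N} → (Fin N → ℤ) → ℕ → ℕ → List (Subset N)
  2-chain x v zero = []
  2-chain x v (suc m) = not-div x (2 ^ suc v) ∷ 2-chain x (suc v) m

  -- Zero sums with unit weights, modulo coprime products and prime powers.

  module _ {N : ℕ} (F : Subset N) (x : Fin N → ℤ) where

    record Solvable (m : ℕ) : Set where
      field
        weight : Fin N → ℤ
        units  : ∀ {i} → i ∈ F → Unit m (weight i)
        zero-sum : + m ∣ wsum F x weight

    solvable-∣ : ∀ {m n} → + m ∣ + n → Solvable n → Solvable m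
    solvable-∣ m∣n S =
      record { weight = weight ; units = unit-mod-∣ m∣n ∘ units ; zero-sum = ∣-trans m∣n zero-sum }
      where open Solvable S

    all-divisible⇒solvable : ∀ {m} → (∀ {i} → i ∈ F → + m ∣ x i) → Solvable m
    all-divisible⇒solvable {m} m∣ = record
      { weight = λ _ → 1ℤ ; units = λ _ → unit-1 m ; zero-sum = wsum-∣ F x (λ _ → 1ℤ) m∣ }

    -- Chinese remainder theorem: `bezout` gives `v * n + u * m = 1`, so the combination of the two
    -- weight functions with coefficients `v * n` and `u * m` agrees with the first modulo `m` and
    -- with the second modulo `n`.
    solvable-* : ∀ {m n} → Unit m (+ n) → Solvable m → Solvable n → Solvable (m ℕ.* n)
    solvable-* {m} {n} (unit v (divides u′ bezout)) A B = record
      { weight = weight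
      ; units = λ i∈F → unit-mod-* (unit-cong (≡A _) (A.units i∈F)) (unit-cong (≡B _) (B.units i∈F))
      ; zero-sum = subst₂ _∣_ (sym (ℤₚ.pos-* m n)) (sym sum≡)
          (∣m∣n⇒∣m+n
            (subst (_∣ v * + n * wsum F x A.weight) (ℤₚ.*-comm (+ n) (+ m)) (∣-* (∣n⇒∣m*n v ∣-refl) A.zero-sum))
            (∣-* (∣n⇒∣m*n u ∣-refl) B.zero-sum)) }
      where
      module A = Solvable A
      module B = Solvable B
      u : ℤ
      u = - u′
      weight : Fin N → ℤ
      weight i = v * + n * A.weight i + u * + m * B.weight i
      sum≡ : wsum F x weight ≡ v * + n * wsum F x A.weight + u * + m * wsum F x B.weight
      sum≡ = trans (wsum-+ F x (λ i → v * + n * A.weight i) (λ i → u * + m * B.weight i))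
        (cong₂ _+_ (wsum-* F x (v * + n) A.weight) (wsum-* F x (u * + m) B.weight))
      um : u * + m ≡ 1ℤ - v * + n
      um = trans (sym (ℤₚ.neg-distribˡ-* u′ (+ m))) (trans (cong -_ (sym bezout)) (eq (+ n) v))
        where
        eq : ∀ n v → - (n * v - 1ℤ) ≡ 1ℤ - v * n
        eq = solve-∀
      ≡A : ∀ i → + m ∣ weight i - A.weight i
      ≡A i = divides ((B.weight i - A.weight i) * u) (trans
        (cong (λ w → v * + n * A.weight i + w * B.weight i - A.weight i) um)
        (trans (eq (v * + n) (A.weight i) (B.weight i))
          (trans (cong ((B.weight i - A.weight i) *_) (sym um)) (sym (ℤₚ.*-assoc (B.weight i - A.weight i) u (+ m))))))
        where
        eq : ∀ e a b → e * a + (1ℤ - e) * b - a ≡ (b - a) * (1ℤ - e)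
        eq = solve-∀
      ≡B : ∀ i → + n ∣ weight i - B.weight i
      ≡B i = divides ((A.weight i - B.weight i) * v) (trans
        (cong (λ w → v * + n * A.weight i + w * B.weight i - B.weight i) um)
        (eq v (+ n) (A.weight i) (B.weight i)))
        where
        eq : ∀ v n a b → v * n * a + (1ℤ - v * n) * b - b ≡ (a - b) * v * n
        eq = solve-∀

    -- Apart from those of xᵢ and xⱼ all weights are 1; the weight u of xᵢ being given, that of
    -- xⱼ is forced.
    two-weights : ∀ {p} e → Prime p → ∀ g {i j} → i ∈ F → j ∈ F → i ≢ j → ∀ y z t u →
                  x i ≡ g * y → x j ≡ g * z → wsum F x (λ _ → 1ℤ) ≡ g * t →
                  ¬ (+ p ∣ z) → ¬ (+ p ∣ u) → ¬ (+ p ∣ t - y - z + u * y) → Solvable (p ^ e)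
    two-weights {p} e p-prime g {i} {j} i∈F j∈F i≢j y z t u xi xj sum≡ p∤z p∤u p∤c
      with unit-mod-^ e (prime⇒unit p-prime p∤z)
    ... | unit w zw =
      record { weight = weight
      ; units = λ {k} _ → unit-at k (i Fin.≟ k) (j Fin.≟ k)
      ; zero-sum = subst (+ (p ^ e) ∣_) (sym wsum≡) (∣n⇒∣m*n (- (g * c)) zw) }
      where
      c v : ℤ
      -- `g * c` is the weighted sum without its term at `j`: from the sum with weights 1 the terms
      -- at `i` and `j` are removed and the one at `i` is restored with weight `u`. As `w` inverts
      -- `z`, the weight `v` at `j` cancels it modulo `p ^ e`.
      c = t - y - z + u * y
      v = - (c * w)
      unit-v : Unit (p ^ e) v
      unit-v = unit-neg (unit-* (unit-mod-^ e (prime⇒unit p-prime p∤c)) (unit-sym {y = z} (unit w zw)))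
      weight : Fin N → ℤ
      weight k = 1ℤ + ((u - 1ℤ) * δ i k + (v - 1ℤ) * δ j k)
      weight-cong : ∀ {k α β} → δ i k ≡ α → δ j k ≡ β → weight k ≡ 1ℤ + ((u - 1ℤ) * α + (v - 1ℤ) * β)
      weight-cong refl refl = refl
      unit-at : ∀ k → Dec (i ≡ k) → Dec (j ≡ k) → Unit (p ^ e) (weight k)
      unit-at _ (yes refl) _ = subst (Unit (p ^ e)) (sym (trans (weight-cong (δ-refl i) (δ-≢ (i≢j ∘ sym))) (eq u v)))
              (unit-mod-^ e (prime⇒unit p-prime p∤u))
        where
        eq : ∀ u v → 1ℤ + ((u - 1ℤ) * 1ℤ + (v - 1ℤ) * 0ℤ) ≡ u
        eq = solve-∀
      unit-at _ (no i≢k) (yes refl) =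
        subst (Unit (p ^ e)) (sym (trans (weight-cong (δ-≢ i≢j) (δ-refl j)) (eq u v))) unit-v
        where
        eq : ∀ u v → 1ℤ + ((u - 1ℤ) * 0ℤ + (v - 1ℤ) * 1ℤ) ≡ v
        eq = solve-∀
      unit-at k (no i≢k) (no j≢k) =
        subst (Unit (p ^ e)) (sym (trans (weight-cong (δ-≢ i≢k) (δ-≢ j≢k)) (eq u v))) (unit-1 (p ^ e))
        where
        eq : ∀ u v → 1ℤ + ((u - 1ℤ) * 0ℤ + (v - 1ℤ) * 0ℤ) ≡ 1ℤ
        eq = solve-∀
      wsum≡ : wsum F x weight ≡ - (g * c) * (z * w - 1ℤ)
      wsum≡ = begin
        wsum F x weight
          ≡⟨ wsum-+ F x (λ _ → 1ℤ) (λ k → (u - 1ℤ) * δ i k + (v - 1ℤ) * δ j k) ⟩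
        wsum F x (λ _ → 1ℤ) + wsum F x (λ k → (u - 1ℤ) * δ i k + (v - 1ℤ) * δ j k)
          ≡⟨ cong₂ _+_ sum≡ (wsum-+ F x (λ k → (u - 1ℤ) * δ i k) (λ k → (v - 1ℤ) * δ j k)) ⟩
        g * t + (wsum F x (λ k → (u - 1ℤ) * δ i k) + wsum F x (λ k → (v - 1ℤ) * δ j k))
          ≡⟨ cong (λ s → g * t + s) (cong₂ _+_ (scaled (u - 1ℤ) i∈F xi) (scaled (v - 1ℤ) j∈F xj)) ⟩
        g * t + ((u - 1ℤ) * (g * y) + (v - 1ℤ) * (g * z))
          ≡⟨ eq g t u w y z ⟩
        - (g * c) * (z * w - 1ℤ) ∎
        where
        open ≡-Reasoning
        scaled : ∀ r {k s} → k ∈ F → x k ≡ s → wsum F x (λ l → r * δ k l) ≡ r * s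
        scaled r {k} k∈F eq = trans (wsum-* F x r (δ k)) (cong (r *_) (trans (wsum-δ F x k∈F) eq))
        eq : ∀ g t u w y z → g * t + ((u - 1ℤ) * (g * y) + (- ((t - y - z + u * y) * w) - 1ℤ) * (g * z))
                           ≡ - (g * (t - y - z + u * y)) * (z * w - 1ℤ)
        eq = solve-∀

    none-outside : ∀ q → ∣ F ∩ not-div x q ∣ ≡ 0 → ∀ {i} → i ∈ F → + q ∣ x i
    none-outside q eq {i} i∈F with + q ∣? x i
    ... | yes d = d
    ... | no q∤ = contradiction (subst (0 <_) eq (∈⇒0<∣∣ (x∈p∩q⁺ (i∈F , ∈not-dividing⁺ x q∤)))) λ ()

    -- Two terms of F of the least p-adic valuation v, as p^v·y and p^v·z.
    record LowestPair (p v : ℕ) : Set where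
      field
        {i j} : Fin N
        i∈F : i ∈ F
        j∈F : j ∈ F
        i≢j : i ≢ j
        y z t : ℤ
        xi : x i ≡ + (p ^ v) * y
        xj : x j ≡ + (p ^ v) * z
        sum≡ : wsum F x (λ _ → 1ℤ) ≡ + (p ^ v) * t
        p∤y : ¬ (+ p ∣ y)
        p∤z : ¬ (+ p ∣ z)

    ∣⇒≡* : ∀ {d w} (d∣w : d ∣ w) → w ≡ d * quotient d∣w
    ∣⇒≡* {d} (divides q eq) = trans eq (ℤₚ.*-comm q d)

    lowest-pair : ∀ p v → (∀ {i} → i ∈ F → + (p ^ v) ∣ x i) →
                  0 < ∣ F ∩ not-div x (p ^ suc v) ∣ → ∣ F ∩ not-div x (p ^ suc v) ∣ ≢ 1 → LowestPair p v
    lowest-pair p v p^v∣ 0< ≢1 with 0<∣∣⇒Nonempty (F ∩ not-div x (p ^ suc v)) 0<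
    ... | i , i∈ with 0<∣∣⇒Nonempty ((F ∩ not-div x (p ^ suc v)) Data.Fin.Subset.- i)
                       (ℕₚ.n≢0⇒n>0 λ eq → ≢1 (trans (sym (∣-∣ (F ∩ not-div x (p ^ suc v)) i∈)) (cong suc eq)))
    ... | j , j∈- = record
      { i∈F = i∈F ; j∈F = j∈F ; i≢j = i≢j
      ; xi = ∣⇒≡* (p^v∣ i∈F) ; xj = ∣⇒≡* (p^v∣ j∈F) ; sum≡ = ∣⇒≡* (wsum-∣ F x (λ _ → 1ℤ) p^v∣)
      ; p∤y = p∤ i∈ ; p∤z = p∤ j∈ }
      where
      j∈ : j ∈ F ∩ not-div x (p ^ suc v)
      j∈ = p─q⊆p (F ∩ not-div x (p ^ suc v)) ⁅ i ⁆ j∈-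
      i∈F : i ∈ F
      i∈F = p∩q⊆p F _ i∈
      j∈F : j ∈ F
      j∈F = p∩q⊆p F _ j∈
      i≢j : i ≢ j
      i≢j refl = ─⇒∉ (F ∩ not-div x (p ^ suc v)) ⁅ i ⁆ j∈- (x∈⁅x⁆ i)
      p∤ : ∀ {k} (k∈ : k ∈ F ∩ not-div x (p ^ suc v)) → ¬ (+ p ∣ quotient (p^v∣ (p∩q⊆p F _ k∈)))
      p∤ k∈ d = ∈not-dividing⁻ x (p∩q⊆q F _ k∈)
        (subst₂ _∣_ (sym (ℤₚ.pos-* p (p ^ v))) (sym (_∣_.equality (p^v∣ (p∩q⊆p F _ k∈)))) (∣-* d ∣-refl))

    lowest-valuation : ∀ p e → (∀ {i} → i ∈ F → + (p ^ e) ∣ x i) ⊎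
      (∃[ v ] v < e × (∀ {i} → i ∈ F → + (p ^ v) ∣ x i) × 0 < ∣ F ∩ not-div x (p ^ suc v) ∣)
    lowest-valuation p zero = inj₁ λ {i} _ → divides (x i) (sym (ℤₚ.*-identityʳ (x i)))
    lowest-valuation p (suc e) with lowest-valuation p e
    ... | inj₂ (v , v<e , rest) = inj₂ (v , ℕₚ.m<n⇒m<1+n v<e , rest)
    ... | inj₁ p^e∣ with ∣ F ∩ not-div x (p ^ suc e) ∣ in eq
    ... | zero = inj₁ (none-outside (p ^ suc e) eq)
    ... | suc _ = inj₂ (e , ℕₚ.≤-refl , p^e∣ , subst (0 <_) (sym eq) (s≤s z≤n))

    -- The weights 1 and -1 are tried at `i`. If both left a coefficient divisible by `p`, so would
    -- be the difference `2 * y`, which is impossible for odd `p`.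
    odd-pair⇒solvable : ∀ {p v} e → Prime p → ¬ (+ p ∣ + 2) → LowestPair p v → Solvable (p ^ e)
    odd-pair⇒solvable {p} {v} e p-prime p∤2 L
      with + p ∣? (L.t - L.y - L.z + 1ℤ * L.y) | + p ∣? (L.t - L.y - L.z + - 1ℤ * L.y)
      where module L = LowestPair L
    ... | no p∤c | _ =
      two-weights e p-prime (+ (p ^ v)) i∈F j∈F i≢j y z t 1ℤ xi xj sum≡ p∤z (p∤1 p-prime) p∤c
      where open LowestPair L
    ... | yes _ | no p∤c =
      two-weights e p-prime (+ (p ^ v)) i∈F j∈F i≢j y z t (- 1ℤ)
      xi xj sum≡ p∤z (p∤1 p-prime ∘ ∣m⇒∣-m) p∤c
      where open LowestPair L
    ... | yes d | yes d′ with prime-∣-* p-prime (+ 2) (LowestPair.y L)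
        (subst (+ p ∣_) (eq (LowestPair.t L) (LowestPair.y L) (LowestPair.z L)) (∣m∣n⇒∣m-n d d′))
      where
      eq : ∀ t y z → t - y - z + 1ℤ * y - (t - y - z + - 1ℤ * y) ≡ + 2 * y
      eq = solve-∀
    ... | inj₁ p∣2 = contradiction p∣2 p∤2
    ... | inj₂ p∣y = contradiction p∣y (LowestPair.p∤y L)

    odd-prime-power-solvable : ∀ {p} e → Prime p → ¬ (+ p ∣ + 2) →
      (∀ j → j < e → ∣ F ∩ not-div x (p ^ suc j) ∣ ≢ 1) → Solvable (p ^ e)
    odd-prime-power-solvable {p} e p-prime p∤2 ≢1 with lowest-valuation p e
    ... | inj₁ p^e∣ = all-divisible⇒solvable p^e∣
    ... | inj₂ (v , v<e , p^v∣ , 0<) = odd-pair⇒solvable e p-prime p∤2 (lowest-pair p v p^v∣ 0< (≢1 v v<e))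

    -- With weight 1 at `i` the coefficient left to cancel is `t - z`. The terms not divisible by
    -- `2^(v+1)` are `2^v` modulo `2^(v+1)` and even in number, so `t` is even, while `z` is odd.
    even-pair⇒solvable : ∀ v e → (∀ {i} → i ∈ F → + (2 ^ v) ∣ x i) →
      parity ∣ F ∩ not-div x (2 ^ suc v) ∣ ≡ 0ℙ → LowestPair 2 v → Solvable (2 ^ e)
    even-pair⇒solvable v e 2^v∣ even L =
      two-weights e prime[2] (+ (2 ^ v)) i∈F j∈F i≢j y z t 1ℤ xi xj sum≡ p∤z (p∤1 prime[2])
        λ d → p∤z (subst (+ 2 ∣_) (eq t y z) (∣m∣n⇒∣m-n 2∣t d))
      where
      open LowestPair L
      eq : ∀ t y z → t - (t - y - z + 1ℤ * y) ≡ z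
      eq = solve-∀
      g : ℤ
      g = + (2 ^ v)
      2g≡ : + (2 ^ suc v) ≡ + 2 * g
      2g≡ = ℤₚ.pos-* 2 (2 ^ v)
      instance
        g≢0 : ℤ.NonZero g
        g≢0 = ℕₚ.m^n≢0 2 v
      in-S : ∀ {k} → k ∈ F → k ∈ not-div x (2 ^ suc v) → + (2 ^ suc v) ∣ x k - g
      in-S {k} k∈F k∈ with 2^v∣ k∈F
      ... | divides q xk with even-or-odd q
      ... | inj₁ 2∣q = contradiction (subst₂ _∣_ (sym 2g≡) (sym xk) (∣-* 2∣q ∣-refl)) (∈not-dividing⁻ x k∈)
      ... | inj₂ 2∣q-1 = subst₂ _∣_ (sym 2g≡) (trans (eq′ q g) (cong (_- g) (sym xk))) (∣-* 2∣q-1 ∣-refl)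
        where
        eq′ : ∀ q g → (q - 1ℤ) * g ≡ q * g - g
        eq′ = solve-∀
      out-S : ∀ {k} → k ∈ F → k ∉ not-div x (2 ^ suc v) → + (2 ^ suc v) ∣ x k
      out-S {k} k∈F k∉ with + (2 ^ suc v) ∣? x k
      ... | yes d = d
      ... | no ¬d = contradiction (∈not-dividing⁺ x ¬d) k∉
      2∣t : + 2 ∣ t
      2∣t = *-cancelʳ-∣ g (subst₂ _∣_ 2g≡ (trans sum≡ (ℤₚ.*-comm g t))
        (∣m+n∣n⇒∣m (wsum-count F (not-div x (2 ^ suc v)) x in-S out-S)
          (∣m⇒∣-m (subst (_∣ + ∣ F ∩ not-div x (2 ^ suc v) ∣ * g) (sym 2g≡)
            (∣-* {+ 2} {+ ∣ F ∩ not-div x (2 ^ suc v) ∣} {g} (∣ᵤ⇒∣ (even⇒2∣ _ even)) ∣-refl)))))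

    -- A missed set raises the known common divisor from `2^v` to `2^(v+1)`. The first set that is
    -- met consists, within `F`, of the terms of least valuation, and there are evenly many of them.
    2-power-solvable : ∀ v m → Balanced F (2-chain x v m) →
      (∀ {i} → i ∈ F → + (2 ^ v) ∣ x i) → Solvable (2 ^ (v ℕ.+ m))
    2-power-solvable v zero [] 2^v∣ =
      subst (Solvable ∘ (2 ^_)) (sym (ℕₚ.+-identityʳ v)) (all-divisible⇒solvable 2^v∣)
    2-power-solvable v (suc m) (meets 0< even) 2^v∣ =
      even-pair⇒solvable v (v ℕ.+ suc m) 2^v∣ even
        (lowest-pair 2 v 2^v∣ 0< λ eq → contradiction (trans (sym even) (cong parity eq)) λ ())
    2-power-solvable v (suc m) (misses none bal) 2^v∣ = subst (Solvable ∘ (2 ^_)) (sym (ℕₚ.+-suc v m))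
      (2-power-solvable (suc v) m bal (none-outside (2 ^ suc v) none))

  -- Prime-power divisors of a product of primes.

  prime-∣-^ : ∀ {p} q e → Prime p → Prime q → p ℕ.∣ q ^ e → p ≡ q
  prime-∣-^ q zero p-prime q-prime d = contradiction (subst Prime (ℕ.∣1⇒≡1 d) p-prime) ¬prime[1]
  prime-∣-^ q (suc e) p-prime q-prime d with euclidsLemma q (q ^ e) p-prime d
  ... | inj₂ p∣q^e = prime-∣-^ q e p-prime q-prime p∣q^e
  ... | inj₁ p∣q with prime⇒irreducible q-prime p∣q
  ... | inj₁ p≡1 = contradiction (subst Prime p≡1 p-prime) ¬prime[1]
  ... | inj₂ p≡q = p≡q

  prime-power-∣-* : ∀ {p q} e m → Prime p → Prime q → p ≢ q → p ^ e ℕ.∣ q ℕ.* m → p ^ e ℕ.∣ m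
  prime-power-∣-* {p} {q} e m p-prime q-prime p≢q = ℕ.coprime-divisor coprime
    where
    coprime : ℕ.Coprime (p ^ e) q
    coprime (d∣p^e , d∣q) with prime⇒irreducible q-prime d∣q
    ... | inj₁ d≡1 = d≡1
    ... | inj₂ refl = contradiction (sym (prime-∣-^ p e q-prime p-prime d∣p^e)) p≢q

  prime-power-∣-^* : ∀ {p q} e s m → Prime p → Prime q → p ≢ q → p ^ e ℕ.∣ q ^ s ℕ.* m → p ^ e ℕ.∣ m
  prime-power-∣-^* {p} e zero m _ _ _ d = subst (p ^ e ℕ.∣_) (ℕₚ.*-identityˡ m) d
  prime-power-∣-^* {p} {q} e (suc s) m p-prime q-prime p≢q d =
    prime-power-∣-^* e s m p-prime q-prime p≢q
      (prime-power-∣-* e (q ^ s ℕ.* m) p-prime q-prime p≢q (subst (p ^ e ℕ.∣_) (ℕₚ.*-assoc q (q ^ s) m) d))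

  prime>1 : ∀ {p} → Prime p → 1 < p
  prime>1 {p} p-prime = ℕ.nonTrivial⇒n>1 p {{prime⇒nonTrivial p-prime}}

  record PrimePart (p m : ℕ) : Set where
    field
      exponent rest : ℕ
      m≡  : m ≡ p ^ exponent ℕ.* rest
      p∤ : ¬ (p ℕ.∣ rest)

  prime-part′ : ∀ p m → Prime p → 0 < m → Acc _<_ m → PrimePart p m
  prime-part′ p m p-prime 0<m (acc rec) with p ℕ.∣? m
  ... | no p∤m = record { exponent = 0 ; rest = m ; m≡ = sym (ℕₚ.*-identityˡ m) ; p∤ = p∤m }
  ... | yes (ℕ.divides q refl) = record
    { exponent = suc exponent ; rest = rest ; p∤ = p∤
    ; m≡ = trans (ℕₚ.*-comm q p) (trans (cong (p ℕ.*_) m≡) (sym (ℕₚ.*-assoc p (p ^ exponent) rest))) }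
    where
    0<q : 0 < q
    0<q = ℕₚ.n≢0⇒n>0 λ { refl → contradiction 0<m λ () }
    q< : q < q ℕ.* p
    q< = ℕₚ.m<m*n q p {{ℕ.>-nonZero 0<q}} (prime>1 p-prime)
    open PrimePart (prime-part′ p q p-prime 0<q (rec q<))

  prime-part : ∀ {p m} → Prime p → 0 < m → PrimePart p m
  prime-part {p} {m} p-prime 0<m = prime-part′ p m p-prime 0<m (<-wellFounded m)

  exists-prime-divisor : ∀ m → 1 < m → ∃[ p ] Prime p × p ℕ.∣ m
  exists-prime-divisor m 1<m with factorise m {{ℕ.>-nonZero (ℕₚ.<-trans (s≤s z≤n) 1<m)}}
  ... | record { factors = [] ; isFactorisation = refl } = contradiction 1<m λ { (s≤s ()) }
  ... | record { factors = p ∷ ps ; isFactorisation = eq ; factorsPrime = p-prime ∷ _ } =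
    p , p-prime , subst (p ℕ.∣_) (sym eq) (ℕ.m∣m*n (product ps))

  ^-monoʳ-∣ : ∀ p {d e} → d ≤ e → p ^ d ℕ.∣ p ^ e
  ^-monoʳ-∣ p {d} d≤e with ℕₚ.m≤n⇒∃[o]m+o≡n d≤e
  ... | o , refl = subst (p ^ d ℕ.∣_) (sym (ℕₚ.^-distribˡ-+-* p d o)) (ℕ.m∣m*n (p ^ o))

  ^∣^*⇒∣ : ∀ p {s e m} .{{_ : NonZero p}} → s < e → p ^ e ℕ.∣ p ^ s ℕ.* m → p ℕ.∣ m
  ^∣^*⇒∣ p {s} {e} {m} s<e d = ℕ.*-cancelˡ-∣ (p ^ s) {{ℕₚ.m^n≢0 p s}}
    (subst (ℕ._∣ p ^ s ℕ.* m) (ℕₚ.*-comm p (p ^ s)) (ℕ.∣-trans (^-monoʳ-∣ p s<e) d))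

  -- Adjoining a prime `q` to a product with exact `q`-exponent `s` creates one new prime-power
  -- divisor, `q^(s+1)`. One entry per prime factor therefore suffices, which bounds the number of
  -- odd sets by `k`.
  prime-powers : ∀ ps → All Prime ps →
    ∃ λ qs → length qs ≡ length ps × (∀ p e → Prime p → p ^ suc e ℕ.∣ product ps → p ^ suc e ∈ₗ qs)
  prime-powers [] [] = [] , refl , λ p e p-prime d →
    contradiction (prime>1 p-prime) (ℕₚ.≤⇒≯ (ℕₚ.≤-reflexive (ℕ.∣1⇒≡1 (ℕ.∣-trans (ℕ.m∣m*n (p ^ e)) d))))
  prime-powers (q ∷ ps) (q-prime ∷ primes)
    with prime-powers ps primes | prime-part q-prime (productOfPrimes≥1 primes)
  ... | qs , length-qs , complete | record { exponent = s ; rest = m ; m≡ = m≡ ; p∤ = q∤m } =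
    q ^ suc s ∷ qs , cong suc length-qs , complete′
    where
    complete′ : ∀ p e → Prime p → p ^ suc e ℕ.∣ q ℕ.* product ps → p ^ suc e ∈ₗ q ^ suc s ∷ qs
    complete′ p e p-prime d with p ℕₚ.≟ q
    ... | no p≢q = there (complete p e p-prime (prime-power-∣-* (suc e) (product ps) p-prime q-prime p≢q d))
    ... | yes refl with ℕₚ.<-cmp e s
    ... | tri≈ _ refl _ = here refl
    ... | tri< e<s _ _ = there (complete p e p-prime
            (subst (p ^ suc e ℕ.∣_) (sym m≡) (ℕ.∣-trans (^-monoʳ-∣ p e<s) (ℕ.m∣m*n m))))
    ... | tri> _ _ s<e = contradiction
            (^∣^*⇒∣ p {suc s} {suc e} {{prime⇒nonZero p-prime}} (s≤s s<e)
              (subst (p ^ suc e ℕ.∣_) (trans (cong (p ℕ.*_) m≡) (sym (ℕₚ.*-assoc p (p ^ s) m))) d))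
            q∤m

  prime∤product : ∀ {q} ps → Prime q → All (λ p → ¬ (q ℕ.∣ p)) ps → ¬ (q ℕ.∣ product ps)
  prime∤product [] q-prime [] d = ¬prime[1] (subst Prime (ℕ.∣1⇒≡1 d) q-prime)
  prime∤product (p ∷ ps) q-prime (q∤p ∷ q∤ps) d with euclidsLemma p (product ps) q-prime d
  ... | inj₁ q∣p = q∤p q∣p
  ... | inj₂ q∣ps = prime∤product ps q-prime q∤ps q∣ps

  -- Provides the size bound that `select` demands: `n` is at least `2 * 3 ^ k`, its `k` odd prime
  -- factors being at least 3.
  3k+2≤2*3^k : ∀ k → 1 ≤ k → 3 ℕ.* k ℕ.+ 2 ≤ 2 ℕ.* 3 ^ k
  3k+2≤2*3^k (suc zero) _ = ℕₚ.n≤1+n 5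
  3k+2≤2*3^k (suc (suc k)) _ = begin
    3 ℕ.* suc (suc k) ℕ.+ 2          ≡⟨ eq₁ k ⟩
    3 ℕ.+ (3 ℕ.* suc k ℕ.+ 2)        ≤⟨ ℕₚ.+-mono-≤ 3≤ (3k+2≤2*3^k (suc k) (s≤s z≤n)) ⟩
    4 ℕ.* 3 ^ suc k ℕ.+ 2 ℕ.* 3 ^ suc k  ≡⟨ eq₂ (3 ^ suc k) ⟩
    2 ℕ.* 3 ^ suc (suc k)            ∎
    where
    open ℕₚ.≤-Reasoning
    3≤ : 3 ≤ 4 ℕ.* 3 ^ suc k
    3≤ = ℕₚ.≤-trans (ℕₚ.n≤1+n 3) (ℕₚ.m≤m*n 4 (3 ^ suc k) {{ℕₚ.m^n≢0 3 (suc k)}})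
    eq₁ : ∀ k → 3 ℕ.* suc (suc k) ℕ.+ 2 ≡ 3 ℕ.+ (3 ℕ.* suc k ℕ.+ 2)
    eq₁ = ℕ-solve-∀
    eq₂ : ∀ w → 4 ℕ.* w ℕ.+ 2 ℕ.* w ≡ 2 ℕ.* (3 ℕ.* w)
    eq₂ = ℕ-solve-∀

  3^length≤product : ∀ ps → All Prime ps → All (λ p → ¬ (2 ℕ.∣ p)) ps → 3 ^ length ps ≤ product ps
  3^length≤product [] [] [] = s≤s z≤n
  3^length≤product (p ∷ ps) (p-prime ∷ primes) (2∤p ∷ odds) =
    ℕₚ.*-mono-≤ (ℕₚ.≤∧≢⇒< (prime>1 p-prime) λ { refl → 2∤p ℕ.∣-refl }) (3^length≤product ps primes odds)

  -- From prime powers to `n`.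

  module _ {N : ℕ} (F : Subset N) (x : Fin N → ℤ) (n : ℕ)
           (local : ∀ p e → Prime p → p ^ e ℕ.∣ n → Solvable F x (p ^ e)) where

    -- The full power of one prime is split off; the cofactor is smaller and prime to it, so the two
    -- solutions combine by `solvable-*`.
    divisor-solvable : ∀ m → 0 < m → m ℕ.∣ n → Acc _<_ m → Solvable F x m
    divisor-solvable m 0<m m∣n (acc rec) with m ℕₚ.≟ 1
    ... | yes refl = all-divisible⇒solvable F x λ {i} _ → divides (x i) (sym (ℤₚ.*-identityʳ (x i)))
    ... | no m≢1 with exists-prime-divisor m (ℕₚ.≤∧≢⇒< 0<m (m≢1 ∘ sym))
    ... | p , p-prime , p∣m with prime-part p-prime 0<m
    ... | record { exponent = zero ; rest = m′ ; m≡ = m≡ ; p∤ = p∤m′ } =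
      contradiction (subst (p ℕ.∣_) (trans m≡ (ℕₚ.*-identityˡ m′)) p∣m) p∤m′
    ... | record { exponent = suc e ; rest = m′ ; m≡ = refl ; p∤ = p∤m′ } =
      solvable-* F x (unit-mod-^ (suc e) (prime⇒unit p-prime (p∤m′ ∘ ∣⇒∣ᵤ)))
        (local p (suc e) p-prime (ℕ.∣-trans (ℕ.m∣m*n m′) m∣n))
        (divisor-solvable m′ 0<m′ (ℕ.∣-trans (ℕ.n∣m*n (p ^ suc e)) m∣n) (rec m′<m))
      where
      0<m′ : 0 < m′
      0<m′ = ℕₚ.n≢0⇒n>0 λ { refl → p∤m′ (p ℕ.∣0) }
      m′<m : m′ < p ^ suc e ℕ.* m′
      m′<m = subst (m′ <_) (ℕₚ.*-comm m′ (p ^ suc e)) (ℕₚ.m<m*n m′ (p ^ suc e) {{ℕ.>-nonZero 0<m′}}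
        (ℕₚ.^-monoʳ-< p (prime>1 p-prime) {0} {suc e} (s≤s z≤n)))

    locally-solvable⇒solvable : 0 < n → Solvable F x n
    locally-solvable⇒solvable 0<n = divisor-solvable n 0<n ℕ.∣-refl (<-wellFounded n)

  -- Upper bound for the Gao constant.

  module _ (n r : ℕ) (ps : List ℕ) (1≤k : 1 ≤ length ps) (primes : All Prime ps)
           (odds : All (λ p → ¬ (2 ℕ.∣ p)) ps) (n≡ : n ≡ 2 ^ suc r ℕ.* product ps) where

    private
      k : ℕ
      k = length ps

    gao-large : 3 ℕ.* k ℕ.+ 2 ≤ n
    gao-large = begin
      3 ℕ.* k ℕ.+ 2             ≤⟨ 3k+2≤2*3^k k 1≤k ⟩
      2 ℕ.* 3 ^ k               ≤⟨ ℕₚ.*-mono-≤ (ℕₚ.*-monoʳ-≤ 2 (ℕₚ.m^n>0 2 r)) (3^length≤product ps primes odds) ⟩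
      2 ^ suc r ℕ.* product ps  ≡⟨ sym n≡ ⟩
      n                         ∎
      where open ℕₚ.≤-Reasoning

    gao-even : parity n ≡ 0ℙ
    gao-even = trans (cong parity (trans n≡ (ℕₚ.*-assoc 2 (2 ^ r) (product ps)))) (*-homo-* 2 (2 ^ r ℕ.* product ps))

    0<n : 0 < n
    0<n = ℕₚ.≤-trans (s≤s z≤n) (ℕₚ.≤-trans (ℕₚ.m≤n+m 2 (3 ℕ.* k)) gao-large)

    -- For odd `p`, a power dividing `n` divides `product ps`, so the sets of all exponents up to it
    -- are in the robust list. For `p = 2` the exponent is at most `r + 1` because `product ps` is
    -- odd, and the chain reaches that far.
    prime-powers-solvable : ∀ {N qs} (G : Subset N) (x : Fin N → ℤ) →
      (∀ p e → Prime p → p ^ suc e ℕ.∣ product ps → p ^ suc e ∈ₗ qs) →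
      Robust (List.map (not-div x) qs) G → Balanced G (2-chain x 0 (suc r)) →
      ∀ p e → Prime p → p ^ e ℕ.∣ n → Solvable G x (p ^ e)
    prime-powers-solvable G x complete robust balanced p e p-prime d with p ℕₚ.≟ 2
    ... | no p≢2 = odd-prime-power-solvable G x e p-prime
            (λ p∣2 → p≢2 (prime-∣-^ 2 1 p-prime prime[2] (∣⇒∣ᵤ p∣2)))
            λ j j<e → All.lookup (All.map⁻ robust) (complete p j p-prime (ℕ.∣-trans (^-monoʳ-∣ p j<e) p^e∣P))
      where
      p^e∣P : p ^ e ℕ.∣ product ps
      p^e∣P = prime-power-∣-^* {p} e (suc r) (product ps) p-prime prime[2] p≢2 (subst (p ^ e ℕ.∣_) n≡ d)
    ... | yes refl with e ℕₚ.≤? suc r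
    ... | yes e≤ = solvable-∣ G x (∣ᵤ⇒∣ (^-monoʳ-∣ 2 e≤))
            (2-power-solvable G x 0 (suc r) balanced λ {i} _ → divides (x i) (sym (ℤₚ.*-identityʳ (x i))))
    ... | no e≰ = contradiction
      (^∣^*⇒∣ 2 {suc r} {e} (ℕₚ.≰⇒> e≰) (subst (2 ^ e ℕ.∣_) n≡ d))
      (prime∤product ps prime[2] odds)

    -- The selection starts from all indices. Their excess over `n` is `k`, enough for the odd sets
    -- that are met, plus `r + 1`, one for each set of the 2-chain.
    gao-upper : GaoProperty n (U n) (n ℕ.+ (suc r ℕ.+ k))
    gao-upper xs length-xs = set , size , 0<∣∣⇒Nonempty set (subst (0 <_) (sym size) 0<n) , weight ,
      (λ i i∈ → invertible (units i∈)) , mod (subst (+ n ∣_) (sym (ℤₚ.+-identityʳ _)) zero-sum)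
      where
      N : ℕ
      N = length xs
      x : Fin N → ℤ
      x = lookup xs
      powers : ∃ λ qs → length qs ≡ length ps × (∀ p e → Prime p → p ^ suc e ℕ.∣ product ps → p ^ suc e ∈ₗ qs)
      powers = prime-powers ps primes
      qs : List ℕ
      qs = proj₁ powers
      Os : List (Subset N)
      Os = List.map (not-div x) qs
      length-Os : length Os ≡ k
      length-Os = trans (length-map _ qs) (proj₁ (proj₂ powers))
      length-2-chain : ∀ v m → length (2-chain x v m) ≡ m
      length-2-chain v zero = refl
      length-2-chain v (suc m) = cong suc (length-2-chain (suc v) m)
      large : n ℕ.+ met Os ⊤ ℕ.+ length (2-chain x 0 (suc r)) ≤ ∣ ⊤ {N} ∣
      large = begin
        n ℕ.+ met Os ⊤ ℕ.+ length (2-chain x 0 (suc r))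
          ≤⟨ ℕₚ.+-mono-≤ (ℕₚ.+-monoʳ-≤ n (ℕₚ.≤-trans (met≤length Os ⊤) (ℕₚ.≤-reflexive length-Os)))
               (ℕₚ.≤-reflexive (length-2-chain 0 (suc r))) ⟩
        n ℕ.+ k ℕ.+ suc r     ≡⟨ trans (ℕₚ.+-assoc n k (suc r)) (cong (n ℕ.+_) (ℕₚ.+-comm k (suc r))) ⟩
        n ℕ.+ (suc r ℕ.+ k)   ≡⟨ sym length-xs ⟩
        N                     ≡⟨ sym (∣⊤∣≡n N) ⟩
        ∣ ⊤ {N} ∣             ∎
        where open ℕₚ.≤-Reasoning
      open Selection (select Os n gao-even
        (subst (λ l → 3 ℕ.* l ℕ.+ 2 ≤ n) (sym length-Os) gao-large) (2-chain x 0 (suc r)) ⊤ large)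
      open Solvable (locally-solvable⇒solvable set x n
        (prime-powers-solvable set x (proj₂ (proj₂ powers)) robust balanced) 0<n)
      invertible : ∀ {y} → Unit n y → U n y
      invertible {y} (unit z d) = z , mod (subst (λ w → + n ∣ w - 1ℤ) (ℤₚ.*-comm y z) d) , mod d

  -- Weighted selections from a list.

  data Selects (A : ℤ → Set) : List ℤ → ℕ → ℤ → Set where
    []   : Selects A [] 0 0ℤ
    skip : ∀ {x xs l z} → Selects A xs l z → Selects A (x ∷ xs) l z
    pick : ∀ {x xs l z a} → A a → Selects A xs l z → Selects A (x ∷ xs) (suc l) (a * x + z)

  -- Trades index sets for an inductive relation that records only the number of chosen terms and
  -- their weighted sum, and that splits along `++` without arithmetic on indices.
  subset⇒selects : ∀ {A} xs (I : Subset (length xs)) a → (∀ i → i ∈ I → A (a i)) →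
                   Selects A xs ∣ I ∣ (wsum I (lookup xs) a)
  subset⇒selects [] [] a in-A = []
  subset⇒selects (x ∷ xs) (inside ∷ I) a in-A =
    pick (in-A zero here) (subset⇒selects xs I (a ∘ suc) λ i → in-A (suc i) ∘ there)
  subset⇒selects {A} (x ∷ xs) (outside ∷ I) a in-A = subst (Selects A (x ∷ xs) ∣ I ∣) (sym (ℤₚ.+-identityˡ _))
    (skip (subset⇒selects xs I (a ∘ suc) λ i → in-A (suc i) ∘ there))

  record Split (A : ℤ → Set) (xs ys : List ℤ) (l : ℕ) (z : ℤ) : Set where
    field
      {l₁ l₂} : ℕ
      {z₁ z₂} : ℤ
      left  : Selects A xs l₁ z₁
      right : Selects A ys l₂ z₂
      l≡    : l ≡ l₁ ℕ.+ l₂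
      z≡    : z ≡ z₁ + z₂

  split : ∀ {A} xs {ys l z} → Selects A (xs ++ ys) l z → Split A xs ys l z
  split [] s = record { left = [] ; right = s ; l≡ = refl ; z≡ = sym (ℤₚ.+-identityˡ _) }
  split (x ∷ xs) (skip s) = record { left = skip left ; right = right ; l≡ = l≡ ; z≡ = z≡ }
    where open Split (split xs s)
  split (x ∷ xs) (pick {a = a} a∈A s) = record
    { left = pick a∈A left ; right = right ; l≡ = cong suc l≡
    ; z≡ = trans (cong (λ w → a * x + w) z≡) (sym (ℤₚ.+-assoc (a * x) z₁ z₂)) }
    where open Split (split xs s)

  selects-++ : ∀ {A xs l z} ys → Selects A xs l z → Selects A (xs ++ ys) l z
  selects-++ [] [] = []
  selects-++ (y ∷ ys) [] = skip (selects-++ ys [])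
  selects-++ ys (skip s) = skip (selects-++ ys s)
  selects-++ ys (pick a∈A s) = pick a∈A (selects-++ ys s)

  selects-≤length : ∀ {A xs l z} → Selects A xs l z → l ≤ length xs
  selects-≤length [] = z≤n
  selects-≤length (skip s) = ℕₚ.m≤n⇒m≤1+n (selects-≤length s)
  selects-≤length (pick _ s) = s≤s (selects-≤length s)

  selects-none : ∀ {A xs l z} → l ≡ 0 → Selects A xs l z → z ≡ 0ℤ
  selects-none _ [] = refl
  selects-none l≡0 (skip s) = selects-none l≡0 s

  selects-∣ : ∀ {A d xs l z} → All (d ∣_) xs → Selects A xs l z → d ∣ z
  selects-∣ [] [] = divides 0ℤ refl
  selects-∣ (_ ∷ d∣xs) (skip s) = selects-∣ d∣xs s
  selects-∣ (d∣x ∷ d∣xs) (pick {a = a} _ s) = ∣m∣n⇒∣m+n (∣n⇒∣m*n a d∣x) (selects-∣ d∣xs s)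

  selects-scaled : ∀ {A} d xs {l z} → Selects A (List.map (d *_) xs) l z → ∃[ w ] z ≡ d * w × Selects A xs l w
  selects-scaled d [] [] = 0ℤ , sym (ℤₚ.*-zeroʳ d) , []
  selects-scaled d (x ∷ xs) (skip s) = let w , eq , s′ = selects-scaled d xs s in w , eq , skip s′
  selects-scaled d (x ∷ xs) (pick {a = a} a∈A s) =
    let w , eq , s′ = selects-scaled d xs s
    in a * x + w , trans (cong (λ v → a * (d * x) + v) eq) (ring d a x w) , pick a∈A s′
    where
    ring : ∀ d a x w → a * (d * x) + d * w ≡ d * (a * x + w)
    ring = solve-∀

  -- An odd weight times a term that is `g` modulo `2 * g` is again `g`, so modulo `2 * g` the sum
  -- sees only the number of selected terms.
  selects-odd-multiples : ∀ {A g xs l z} → (∀ {a} → A a → + 2 ∣ a - 1ℤ) → All (λ x → + 2 * g ∣ x - g) xs →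
                          Selects A xs l z → + 2 * g ∣ z - + l * g
  selects-odd-multiples odd [] [] = divides 0ℤ refl
  selects-odd-multiples odd (_ ∷ xs≡) (skip s) = selects-odd-multiples odd xs≡ s
  selects-odd-multiples {g = g} odd (x≡ ∷ xs≡) (pick {x} {l = l} {z} {a} a∈A s) =
    subst (+ 2 * g ∣_) (ring a x g z (+ l))
      (∣m∣n⇒∣m+n (∣m∣n⇒∣m+n (∣n⇒∣m*n a x≡) (∣-* (odd a∈A) (∣-refl {g}))) (selects-odd-multiples odd xs≡ s))
    where
    ring : ∀ a x g z l → a * (x - g) + (a - 1ℤ) * g + (z - l * g) ≡ a * x + z - (1ℤ + l) * g
    ring = solve-∀

  -- All terms after the first are even, so selecting the odd first term with an odd weight would
  -- make the sum odd. The first term is therefore skipped, and the rest is divided by 2.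
  powers-unselected : ∀ {A} r (a : Fin r → ℤ) → (∀ {w} → A w → ¬ (+ 2 ∣ w)) → (∀ i → ¬ (+ 2 ∣ a i)) →
    ∀ {l z} → Selects A (tabulate λ i → + (2 ^ toℕ i) * a i) l z → + (2 ^ r) ∣ z → l ≡ 0
  powers-unselected zero a A-odd a-odd [] _ = refl
  powers-unselected {A} (suc r) a A-odd a-odd {l} {z} s 2^∣z = go s
    where
    terms : List ℤ
    terms = tabulate {n = r} λ i → + (2 ^ toℕ i) * a (suc i)
    tail≡ : tabulate {n = r} (λ i → + (2 ^ suc (toℕ i)) * a (suc i)) ≡ List.map (+ 2 *_) terms
    tail≡ = trans
      (tabulate-cong λ i → trans (cong (_* a (suc i)) (ℤₚ.pos-* 2 (2 ^ toℕ i)))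
      (ℤₚ.*-assoc (+ 2) (+ (2 ^ toℕ i)) (a (suc i))))
      (sym (map-tabulate (λ i → + (2 ^ toℕ i) * a (suc i)) (+ 2 *_)))
    2^∣ : ∀ {w} → z ≡ + 2 * w → + (2 ^ r) ∣ w
    2^∣ {w} eq = *-cancelˡ-∣ (+ 2) (subst₂ _∣_ (ℤₚ.pos-* 2 (2 ^ r)) eq 2^∣z)
    go : Selects A (tabulate λ i → + (2 ^ toℕ i) * a i) l z → l ≡ 0
    go (skip s) with selects-scaled (+ 2) terms (subst (λ xs → Selects A xs _ _) tail≡ s)
    ... | w , eq , s′ = powers-unselected r (a ∘ suc) A-odd (a-odd ∘ suc) s′ (2^∣ eq)
    go (pick {a = u} u∈A s) with selects-scaled (+ 2) terms (subst (λ xs → Selects A xs _ _) tail≡ s)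
    ... | w , refl , _ with prime-∣-* prime[2] u (1ℤ * a zero)
          (∣m+n∣n⇒∣m (∣-trans (subst (+ 2 ∣_) (sym (ℤₚ.pos-* 2 (2 ^ r))) (∣m⇒∣m*n (+ (2 ^ r)) ∣-refl)) 2^∣z)
            (∣m⇒∣m*n w (∣-refl {+ 2})))
    ... | inj₁ 2∣u = contradiction 2∣u (A-odd u∈A)
    ... | inj₂ 2∣a = contradiction (subst (+ 2 ∣_) (ℤₚ.*-identityˡ (a zero)) 2∣a) (a-odd zero)

  -- The first prime divides every term but the first, which is therefore skipped; the rest is
  -- divided by that prime. The factor `m`, divisible by none of the primes, stays fixed in the
  -- induction.
  primes-unselected : ∀ {A} m k (p : Fin k → ℕ) (b : Fin k → ℤ) → (∀ i → Prime (p i)) →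
    (∀ i → ¬ (p i ℕ.∣ m)) → (∀ i → ¬ (+ p i ∣ b i)) → (∀ i {w} → A w → ¬ (+ p i ∣ w)) →
    ∀ {l z} → Selects A (tabulate λ i → + (m ℕ.* product (take (toℕ i) (tabulate p))) * b i) l z →
    + product (tabulate p) ∣ z → l ≡ 0
  primes-unselected m zero p b _ _ _ _ [] _ = refl
  primes-unselected {A} m (suc k) p b p-prime p∤m p∤b p∤A {l} {z} s ∣z = go s
    where
    p₀ P : ℤ
    p₀ = + p zero
    P = + product (tabulate (p ∘ suc))
    Q : Fin k → ℕ
    Q i = product (take (toℕ i) (tabulate (p ∘ suc)))
    instance
      p₀≢0 : ℤ.NonZero p₀
      p₀≢0 = prime⇒nonZero (p-prime zero)
    terms : List ℤ
    terms = tabulate {n = k} λ i → + (m ℕ.* Q i) * b (suc i)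
    tail≡ : tabulate {n = k} (λ i → + (m ℕ.* (p zero ℕ.* Q i)) * b (suc i)) ≡ List.map (p₀ *_) terms
    tail≡ = trans (tabulate-cong λ i → trans (cong (_* b (suc i))
        (trans (cong +_ (ℕring m (p zero) (Q i))) (ℤₚ.pos-* (p zero) (m ℕ.* Q i))))
        (ℤₚ.*-assoc p₀ (+ (m ℕ.* Q i)) (b (suc i))))
      (sym (map-tabulate (λ i → + (m ℕ.* Q i) * b (suc i)) (p₀ *_)))
      where
      ℕring : ∀ m p q → m ℕ.* (p ℕ.* q) ≡ p ℕ.* (m ℕ.* q)
      ℕring = ℕ-solve-∀
    p₀P∣z : p₀ * P ∣ z
    p₀P∣z = subst (_∣ z) (ℤₚ.pos-* (p zero) _) ∣z
    go : Selects A (tabulate λ i → + (m ℕ.* product (take (toℕ i) (tabulate p))) * b i) l z → l ≡ 0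
    go (skip s) with selects-scaled p₀ terms (subst (λ xs → Selects A xs _ _) tail≡ s)
    ... | w , eq , s′ =
      primes-unselected m k (p ∘ suc) (b ∘ suc) (p-prime ∘ suc) (p∤m ∘ suc) (p∤b ∘ suc)
      (λ i → p∤A (suc i)) s′
            (*-cancelˡ-∣ p₀ (subst (p₀ * P ∣_) eq p₀P∣z))
    go (pick {a = u} u∈A s) with selects-scaled p₀ terms (subst (λ xs → Selects A xs _ _) tail≡ s)
    ... | w , refl , _ with prime-∣-* (p-prime zero) u (+ (m ℕ.* 1) * b zero)
          (∣m+n∣n⇒∣m (∣-trans (∣m⇒∣m*n P ∣-refl) p₀P∣z) (∣m⇒∣m*n w (∣-refl {p₀})))
    ... | inj₁ d = contradiction d (p∤A zero u∈A)
    ... | inj₂ d with prime-∣-* (p-prime zero) (+ (m ℕ.* 1)) (b zero) d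
    ... | inj₁ e = contradiction (subst (p zero ℕ.∣_) (ℕₚ.*-identityʳ m) (∣⇒∣ᵤ e)) (p∤m zero)
    ... | inj₂ e = contradiction e (p∤b zero)

  prime∤unit : ∀ {n p w} → Prime p → p ℕ.∣ n → U n w → ¬ (+ p ∣ w)
  prime∤unit {n} {p} {w} p-prime p∣n (v , _ , mod d) p∣w = p∤1 p-prime
    (subst (+ p ∣_) (ring w v) (∣m∣n⇒∣m-n (∣m⇒∣m*n v p∣w) (∣-trans (∣ᵤ⇒∣ p∣n) d)))
    where
    ring : ∀ w v → w * v - (w * v - 1ℤ) ≡ 1ℤ
    ring = solve-∀

  even≤1⇒0 : ∀ {l} → l ≤ 1 → 2 ℕ.∣ l → l ≡ 0
  even≤1⇒0 {zero} _ _ = refl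
  even≤1⇒0 {suc zero} _ d = contradiction (ℕ.∣⇒≤ d) λ { (s≤s ()) }
  even≤1⇒0 {suc (suc _)} (s≤s ()) _

  odd⇒2∣-1 : ∀ y → ¬ (+ 2 ∣ y) → + 2 ∣ y - 1ℤ
  odd⇒2∣-1 y 2∤y with even-or-odd y
  ... | inj₁ 2∣y = contradiction 2∣y 2∤y
  ... | inj₂ 2∣y-1 = 2∣y-1

  odd-multiple : ∀ g y → ¬ (+ 2 ∣ y) → + 2 * g ∣ g * y - g
  odd-multiple g y 2∤y = subst (+ 2 * g ∣_) (ring y g) (∣-* (odd⇒2∣-1 y 2∤y) (∣-refl {g}))
    where
    ring : ∀ y g → (y - 1ℤ) * g ≡ g * y - g
    ring = solve-∀

  -- Absence of weighted zero sums of length `n`.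

  module _ (n r k : ℕ) (1≤k : 1 ≤ k) (p : Fin k → ℕ)
    (p-prime : ∀ i → Prime (p i)) (p-odd : ∀ i → ¬ (2 ℕ.∣ p i))
           (n≡ : n ≡ 2 ^ suc r ℕ.* product (tabulate p)) where

    private
      P : ℕ
      P = product (tabulate p)
      g : ℤ
      g = + (2 ^ r)
      2g≡ : + (2 ^ suc r) ≡ + 2 * g
      2g≡ = ℤₚ.pos-* 2 (2 ^ r)
      odds : All (λ q → ¬ (2 ℕ.∣ q)) (tabulate p)
      odds = All.tabulate⁺ p-odd
      n/2≡ : n / 2 ≡ 2 ^ r ℕ.* P
      n/2≡ = trans (cong (_/ 2) (trans n≡ (ring (2 ^ r) P))) (m*n/n≡m (2 ^ r ℕ.* P) 2)
        where
        ring : ∀ m q → 2 ℕ.* m ℕ.* q ≡ m ℕ.* q ℕ.* 2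
        ring = ℕ-solve-∀
      2^∣n : 2 ^ suc r ℕ.∣ n
      2^∣n = subst (2 ^ suc r ℕ.∣_) (sym n≡) (ℕ.m∣m*n P)
      2∣n : 2 ℕ.∣ n
      2∣n = ℕ.∣-trans (ℕ.m∣m*n (2 ^ r)) 2^∣n
      P∣n : P ℕ.∣ n
      P∣n = subst (P ℕ.∣_) (sym n≡) (ℕ.n∣m*n (2 ^ suc r))
      p∣n : ∀ i → p i ℕ.∣ n
      p∣n i = ℕ.∣-trans (∈⇒∣product (∈-tabulate⁺ i)) P∣n
      0<n′ : 0 < n
      0<n′ = 0<n n r (tabulate p) (subst (1 ≤_) (sym (length-tabulate p)) 1≤k) (All.tabulate⁺ p-prime) odds n≡

    middle : (b : Fin k → ℤ) → List ℤ
    middle b = tabulate λ i → + (2 ^ r ℕ.* product (take (toℕ i) (tabulate p))) * b i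

    no-zero-sum : (a : Fin r → ℤ) → (∀ i → ¬ (+ 2 ∣ a i)) → (c : ℤ) → + (2 ^ suc r) ∣ c →
                  (b : Fin k → ℤ) → (∀ i → ¬ (+ 2 ∣ b i)) → (∀ i → ¬ (+ p i ∣ b i)) →
                  ∀ {z} → + n ∣ z →
                  ¬ Selects (U n)
                    (tabulate (λ i → + (2 ^ toℕ i) * a i) ++ [ c ] ++ middle b ++
                    replicate (n ℕ.∸ 1) (+ (n / 2))) n z
    no-zero-sum a a-odd c 2^∣c b b-odd b-coprime {z} n∣z s = last-contradiction
      where
      U-odd : ∀ {w} → U n w → ¬ (+ 2 ∣ w)
      U-odd = prime∤unit prime[2] 2∣n
      module A = Split (split (tabulate {n = r} λ i → + (2 ^ toℕ i) * a i) s)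
      module C = Split (split [ c ] A.right)
      module M = Split (split (middle b) C.right)

      n/2-terms : List ℤ
      n/2-terms = replicate (n ℕ.∸ 1) (+ (n / 2))
      -- Middle terms and copies of `n / 2` are all odd multiples of `2^r`; they form one block at
      -- the prime 2 and are separated only afterwards.
      odd-multiples : All (λ x → + 2 * g ∣ x - g) (middle b ++ n/2-terms)
      odd-multiples = All.++⁺ (All.tabulate⁺ λ i → subst (λ x → + 2 * g ∣ x - g)
          (trans (sym (ℤₚ.*-assoc g _ (b i))) (cong (_* b i) (sym (ℤₚ.pos-* (2 ^ r) _))))
          (odd-multiple g _ (λ d → no-even i (prime-∣-* prime[2] _ (b i) d))))
        (All.replicate⁺ (n ℕ.∸ 1) (subst (λ x → + 2 * g ∣ x - g)
          (trans (sym (ℤₚ.pos-* (2 ^ r) P)) (cong +_ (sym n/2≡)))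
          (odd-multiple g (+ P) (prime∤product (tabulate p) prime[2] odds ∘ ∣⇒∣ᵤ))))
        where
        no-even : ∀ i → ¬ ((+ 2 ∣ + product (take (toℕ i) (tabulate p))) ⊎ (+ 2 ∣ b i))
        no-even i (inj₁ d) = prime∤product _ prime[2] (All.take⁺ (toℕ i) odds) (∣⇒∣ᵤ d)
        no-even i (inj₂ d) = b-odd i d

      2g∣z : + 2 * g ∣ z
      2g∣z = subst (_∣ z) 2g≡ (∣-trans (∣ᵤ⇒∣ 2^∣n) n∣z)
      2g∣C : + 2 * g ∣ C.z₁
      2g∣C = selects-∣ (subst (_∣ c) 2g≡ 2^∣c ∷ []) C.left
      2g∣CM : + 2 * g ∣ C.z₂ - + C.l₂ * g
      2g∣CM = selects-odd-multiples (odd⇒2∣-1 _ ∘ U-odd) odd-multiples C.right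
      g∣2g : g ∣ + 2 * g
      g∣2g = ∣n⇒∣m*n (+ 2) ∣-refl

      -- Modulo `2^r` the term `c` and the block of odd multiples vanish, so the contribution of the
      -- leading terms is divisible by `2^r`.
      A-empty : A.l₁ ≡ 0
      A-empty = powers-unselected r a U-odd a-odd A.left (subst (g ∣_) (ring A.z₁ C.z₁ C.z₂ (+ C.l₂ * g))
        (∣m∣n⇒∣m-n (∣m∣n⇒∣m-n
          (∣-trans g∣2g (subst (+ 2 * g ∣_) (trans A.z≡ (cong (λ w → A.z₁ + w) C.z≡)) 2g∣z))
          (∣-trans g∣2g 2g∣C))
          (∣m∣n⇒∣m+n (∣-trans g∣2g 2g∣CM) (∣n⇒∣m*n (+ C.l₂) ∣-refl))))
        where
        ring : ∀ x y z w → x + (y + z) - y - (z - w + w) ≡ x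
        ring = solve-∀
      z≡ : z ≡ C.z₁ + C.z₂
      z≡ = trans A.z≡ (trans (cong₂ _+_ (selects-none A-empty A.left) C.z≡) (ℤₚ.+-identityˡ _))
      n≡C : n ≡ C.l₁ ℕ.+ C.l₂
      n≡C = trans A.l≡ (cong₂ ℕ._+_ A-empty C.l≡)

      instance
        g≢0 : ℤ.NonZero g
        g≢0 = ℕₚ.m^n≢0 2 r
      -- Modulo `2 * g` the whole sum is `l₂ * g`, and `g` can be cancelled.
      2∣l₂ : 2 ℕ.∣ C.l₂
      2∣l₂ = ∣⇒∣ᵤ (*-cancelʳ-∣ g {+ 2} {+ C.l₂} (subst (+ 2 * g ∣_) (ring C.z₁ C.z₂ (+ C.l₂ * g))
        (∣m∣n⇒∣m-n (∣m∣n⇒∣m-n (subst (+ 2 * g ∣_) z≡ 2g∣z) 2g∣C) 2g∣CM)))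
        where
        ring : ∀ y z w → y + z - y - (z - w) ≡ w
        ring = solve-∀
      -- Both `n` and `l₂` are even, hence so is `l₁`, which is at most 1.
      C-empty : C.l₁ ≡ 0
      C-empty = even≤1⇒0 (selects-≤length C.left)
        (ℕ.∣m+n∣m⇒∣n (subst (2 ℕ.∣_) (trans n≡C (ℕₚ.+-comm C.l₁ C.l₂)) 2∣n) 2∣l₂)
      z≡M : z ≡ M.z₁ + M.z₂
      z≡M = trans z≡ (trans (cong₂ _+_ (selects-none C-empty C.left) M.z≡) (ℤₚ.+-identityˡ _))
      n≡M : n ≡ M.l₁ ℕ.+ M.l₂
      n≡M = trans n≡C (cong₂ ℕ._+_ C-empty M.l≡)

      P∣n/2 : + P ∣ + (n / 2)
      P∣n/2 = ∣ᵤ⇒∣ (subst (P ℕ.∣_) (sym n/2≡) (ℕ.n∣m*n (2 ^ r)))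
      -- The copies of `n / 2` vanish modulo `P`, so the selected middle terms alone have a sum
      -- divisible by `P`.
      M-empty : M.l₁ ≡ 0
      M-empty = primes-unselected (2 ^ r) k p b p-prime
        (λ i d → p-odd i (subst (ℕ._∣ p i) (prime-∣-^ 2 r (p-prime i) prime[2] d) ℕ.∣-refl))
        b-coprime (λ i → prime∤unit (p-prime i) (p∣n i)) M.left
        (∣m+n∣n⇒∣m (subst (+ P ∣_) z≡M (∣-trans (∣ᵤ⇒∣ P∣n) n∣z)) (selects-∣ (All.replicate⁺ (n ℕ.∸ 1) P∣n/2) M.right))
      last-contradiction : ⊥
      last-contradiction = ℕₚ.<-irrefl refl (begin-strict
        n                       ≡⟨ trans n≡M (cong (ℕ._+ M.l₂) M-empty) ⟩
        M.l₂                    ≤⟨ selects-≤length M.right ⟩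
        length n/2-terms        ≡⟨ length-replicate (n ℕ.∸ 1) ⟩
        n ℕ.∸ 1                 <⟨ ℕₚ.∸-monoʳ-< (s≤s z≤n) 0<n′ ⟩
        n                       ∎)
        where open ℕₚ.≤-Reasoning

  -- For k = 1 the middle term 2^r is the general one with b₁ = 1.
  middleTerms≡ : ∀ r k → 1 ≤ k → (p : Fin k → ℕ) → (∀ i → Prime (p i)) → (b : Fin k → ℤ) →
    (∀ i → ¬ (+ 2 ∣ b i)) → (∀ i → ¬ (+ p i ∣ b i)) →
    ∃ λ (b′ : Fin k → ℤ) → (∀ i → ¬ (+ 2 ∣ b′ i)) × (∀ i → ¬ (+ p i ∣ b′ i)) ×
      middleTerms r p b ≡ tabulate λ i → + (2 ^ r ℕ.* product (take (toℕ i) (tabulate p))) * b′ i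
  middleTerms≡ r (suc zero) _ p p-prime b _ _ =
    (λ _ → 1ℤ) , (λ _ → p∤1 prime[2]) , (λ i → p∤1 (p-prime i)) ,
    cong [_] (sym (trans (ℤₚ.*-identityʳ _) (cong +_ (ℕₚ.*-identityʳ (2 ^ r)))))
  middleTerms≡ r (suc (suc k)) _ p p-prime b b-odd b-coprime = b , b-odd , b-coprime , refl

  -- Minimality of the constant, and the extremal sequence.

  lower-bound : ∀ {n A E} xs → GaoProperty n A E → 1 ≤ E → length xs ≡ E ℕ.∸ 1 →
                (∀ {z} → + n ∣ z → ¬ Selects A xs n z) → GaoExtremal n A xs
  lower-bound {n} {A} {E} xs gao 1≤E length-xs none =
    E , (1≤E , gao , minimal) , length-xs , λ has → no-has xs [] (sym (++-identityʳ xs)) has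
    where
    -- Stated for initial segments `ys`, so as to serve both `xs` and its truncations.
    no-has : ∀ ys zs → xs ≡ ys ++ zs → ¬ HasWeightedZeroSumOfLength n A n ys
    no-has ys zs xs≡ (I , ∣I∣≡n , _ , a , a∈A , mod d) = none d
      (subst₂ (λ us l → Selects A us l _) (sym xs≡) ∣I∣≡n
        (subst (Selects A (ys ++ zs) ∣ I ∣) (sym (ℤₚ.+-identityʳ _)) (selects-++ zs (subset⇒selects ys I a a∈A))))
    -- For `j < E` the sequence `xs`, of length `E - 1`, has an initial segment of length `j`, which
    -- would contain a zero sum of length `n`.
    minimal : ∀ j → 1 ≤ j → GaoProperty n A j → E ≤ j
    minimal j _ gao-j with E ℕₚ.≤? j
    ... | yes E≤j = E≤j
    ... | no E≰j =
      contradiction (gao-j (take j xs) length-take-j)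
      (no-has (take j xs) (drop j xs) (sym (take++drop≡id j xs)))
      where
      length-take-j : length (take j xs) ≡ j
      length-take-j = trans (length-take j xs) (ℕₚ.m≤n⇒m⊓n≡m
        (subst (j ≤_) (sym length-xs) (ℕₚ.∸-monoˡ-≤ 1 (ℕₚ.≰⇒> E≰j))))

  -- The sequence enters as `xs` with an equation because for `k = 1` the middle term `2^r` takes
  -- the general form only after rewriting.
  extremal : (n r k : ℕ) → 1 ≤ k →
    (p : Fin k → ℕ) → (∀ i → Prime (p i)) → (∀ i → ¬ (2 ℕ.∣ p i)) →
    n ≡ 2 ^ suc r ℕ.* product (tabulate p) →
    (a : Fin r → ℤ) → (∀ i → ¬ (+ 2 ∣ a i)) → (c : ℤ) → + (2 ^ suc r) ∣ c →
    (b : Fin k → ℤ) → (∀ i → ¬ (+ 2 ∣ b i)) → (∀ i → ¬ (+ p i ∣ b i)) →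
    ∀ xs → xs ≡ tabulate (λ i → + (2 ^ toℕ i) * a i) ++ [ c ] ++
                tabulate (λ i → + (2 ^ r ℕ.* product (take (toℕ i) (tabulate p))) * b i) ++
                replicate (n ℕ.∸ 1) (+ (n / 2)) →
    GaoExtremal n (U n) xs
  extremal n r k 1≤k p p-prime p-odd n≡ a a-odd c 2^∣c b b-odd b-coprime xs xs≡ =
    lower-bound xs upper
      (ℕₚ.≤-trans (0<n n r (tabulate p) 1≤length primes odds n≡) (ℕₚ.m≤m+n n _))
      (trans (cong length xs≡) length-S)
      λ {z} n∣z s → no-zero-sum n r k 1≤k p p-prime p-odd n≡ a a-odd c 2^∣c b b-odd b-coprime n∣z
        (subst (λ ys → Selects (U n) ys n z) xs≡ s)
    where
    primes : All Prime (tabulate p)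
    primes = All.tabulate⁺ p-prime
    odds : All (λ q → ¬ (2 ℕ.∣ q)) (tabulate p)
    odds = All.tabulate⁺ p-odd
    1≤length : 1 ≤ length (tabulate p)
    1≤length = subst (1 ≤_) (sym (length-tabulate p)) 1≤k
    upper : GaoProperty n (U n) (n ℕ.+ (suc r ℕ.+ k))
    upper = subst (λ l → GaoProperty n (U n) (n ℕ.+ (suc r ℕ.+ l))) (length-tabulate p)
        (gao-upper n r (tabulate p) 1≤length primes odds n≡)
    terms : List ℤ
    terms = tabulate λ i → + (2 ^ r ℕ.* product (take (toℕ i) (tabulate p))) * b i
    length-S :
      length (tabulate (λ i → + (2 ^ toℕ i) * a i) ++ [ c ] ++ terms ++ replicate (n ℕ.∸ 1) (+ (n / 2)))
      ≡ n ℕ.+ (suc r ℕ.+ k) ℕ.∸ 1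
    length-S = begin
      length (tabulate (λ i → + (2 ^ toℕ i) * a i) ++ [ c ] ++ terms ++ replicate (n ℕ.∸ 1) (+ (n / 2)))
        ≡⟨ length-++ (tabulate λ i → + (2 ^ toℕ i) * a i) ⟩
      length (tabulate λ i → + (2 ^ toℕ i) * a i) ℕ.+ suc (length (terms ++ replicate (n ℕ.∸ 1) (+ (n / 2))))
        ≡⟨ cong₂ (λ u v → u ℕ.+ suc v) (length-tabulate _) (length-++ terms) ⟩
      r ℕ.+ suc (length terms ℕ.+ length (replicate (n ℕ.∸ 1) (+ (n / 2))))
        ≡⟨ cong₂ (λ u v → r ℕ.+ suc (u ℕ.+ v)) (length-tabulate _) (length-replicate (n ℕ.∸ 1)) ⟩
      r ℕ.+ suc (k ℕ.+ (n ℕ.∸ 1))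
        ≡⟨ ring r k (n ℕ.∸ 1) ⟩
      n ℕ.∸ 1 ℕ.+ (suc r ℕ.+ k)
        ≡⟨ sym (ℕₚ.+-∸-comm (suc r ℕ.+ k) (0<n n r (tabulate p) 1≤length primes odds n≡)) ⟩
      n ℕ.+ (suc r ℕ.+ k) ℕ.∸ 1 ∎
      where
      open ≡-Reasoning
      ring : ∀ r k m → r ℕ.+ suc (k ℕ.+ m) ≡ m ℕ.+ (suc r ℕ.+ k)
      ring = ℕ-solve-∀

  S-extremal : (n r k : ℕ) → 1 ≤ k →
    (p : Fin k → ℕ) → (∀ i → Prime (p i)) → (∀ i → Odd (+ p i)) →
    n ≡ 2 ^ suc r ℕ.* product (tabulate p) →
    (a : Fin r → ℤ) → (∀ i → Odd (a i)) → (c : ℤ) → + (2 ^ suc r) ∣ c →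
    (b : Fin k → ℤ) → (∀ i → Odd (b i)) → (∀ i → Coprime (b i) (+ p i)) →
    GaoExtremal n (U n) (S n r p a c b)
  S-extremal n r k 1≤k p p-prime p-odd n≡ a a-odd c 2^∣c b b-odd b-coprime =
    let b′ , b′-odd , p∤b′ , middle≡ = middleTerms≡ r k 1≤k p p-prime b b-odd p∤b
    in extremal n r k 1≤k p p-prime (λ i → p-odd i ∘ ∣ᵤ⇒∣) n≡ a a-odd c 2^∣c b′ b′-odd p∤b′ (S n r p a c b)
         (cong (λ ms → tabulate (λ i → + (2 ^ toℕ i) * a i) ++ [ c ] ++ ms ++ replicate (n ℕ.∸ 1) (+ (n / 2)))
           middle≡)
    where
    p∤b : ∀ i → ¬ (+ p i ∣ b i)
    p∤b i d = ¬prime[1] (subst Prime (b-coprime i (∣⇒∣ᵤ d , ℕ.∣-refl)) (p-prime i))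

open import Data.Fin.Base using (Fin)
open import Data.Integer.Base using (ℤ; +_)
open import Data.Integer.Coprimality using (Coprime)
open import Data.Integer.Divisibility.Signed using (_∣_)
open import Data.List.Base using (tabulate)
open import Data.Nat.Base using (ℕ; suc; _≤_; _*_; _^_)
open import Data.Nat.ListAction using (product)
open import Data.Nat.Primality using (Prime)
open import Data.Product.Base using (_×_; proj₁; proj₂)
open import Relation.Binary.PropositionalEquality using (_≡_)
open import Function.Base using (_∘_)

lemma5 : (n r k : ℕ) → 1 ≤ k →
         (p : Fin k → ℕ) → (∀ i → Prime (p i) × Odd (+ p i)) →
         n ≡ 2 ^ suc r * product (tabulate p) →
         (a : Fin r → ℤ) → (∀ i → Odd (a i)) →
         (c : ℤ) → + (2 ^ suc r) ∣ c →
         (b : Fin k → ℤ) → (∀ i → Odd (b i) × Coprime (b i) (+ p i)) →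
         GaoExtremal n (U n) (S n r p a c b)
lemma5 n r k 1≤k p p-odd-prime n≡ a a-odd c 2^∣c b b-odd-coprime =
  WeightedSums.S-extremal n r k 1≤k p (proj₁ ∘ p-odd-prime) (proj₂ ∘ p-odd-prime) n≡
    a a-odd c 2^∣c b (proj₁ ∘ b-odd-coprime) (proj₂ ∘ b-odd-coprime)
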